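{- Let $l,w\ge2$ be integers, and let $P_{l+1}$ be the coefficient of $p^{l+1}$ in the reliability polynomial $h(p)=\sum_{k=l}^{wl}P_kp^k$ of a hammock network of length $l$ and width $w$. Put $\rho=\left\lfloor\frac{l-1}{2}\right\rfloor$ and let $u=(1,1,\dots,1,1)$, $v=(1,1,\dots,1,0)$, $t=(0,1,\dots,1,0)$ be row vectors with $w$ components (for $w=2$, $t=(0,0)$). (a) If $w$ is odd, then for both types of hammock network $$P_{l+1}=-u M v^T,\qquad M=\begin{cases}(M_LM_U)^{\rho}, & l\text{ odd},\\ M_U(M_LM_U)^{\rho}, & l\text{ even}.\end{cases}$$ (b) If $w$ and $l$ are even, then for the network of the first type $$P_{l+1}=-uMt^T,\qquad M=M_-(M_+M_-)^{\rho}.$$ (c) If $w$ and $l$ are even, then for the network of the second type $$P_{l+1}=-uMu^T,\qquad M=M_+(M_-M_+)^{\rho}.$$ (d) If $w$ is even and $l$ is odd, then for both types of hammock network $$P_{l+1}=-\tfrac12\left(uMt^T+uM^Tu^T\right),\qquad M=(M_+M_-)^{\rho}.$$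
   Context: Hammock network of length $l$, width $w$ and given type (first or second): it has $wl$ two-contact relays $c_{i,j}$, $0\le i\le l-1$, $0\le j\le w-1$, each joining a left end to a right end. All left ends of the relays $c_{0,j}$ are identified with the source $S$, and all right ends of the relays $c_{l-1,j}$ with the terminus $T$. For $1\le i\le l-1$ the right end of $c_{i-1,j}$ and the left end of $c_{i,j}$ are identified to a node $(i,j)$; and the nodes $(i,j)$ and $(i,j+1)$ ($0\le j\le w-2$) are moreover joined by a (perfect) wire, i.e. identified, exactly when $i+j$ is even for the first type, and exactly when $i+j$ is odd for the second type. Each relay is independently closed with probability $p$ and open with probability $1-p$; the network is closed if $S$ and $T$ are connected through closed relays (regarded as undirected edges). The reliability polynomial $h(p)$ is the probability that the network is closed. Let $J=\begin{pmatrix}1&1\\1&1\end{pmatrix}$. For odd $w$, $M_U=\mathrm{diag}(J,\dots,J,1)$ and $M_L=\mathrm{diag}(1,J,\dots,J)$ are $w\times w$ block-diagonal matrices with $(w-1)/2$ blocks $J$ and one $1\times1$ block $(1)$. For even $w$, $M_-=\mathrm{diag}(1,J,\dots,J,1)$ (with $(w-2)/2$ blocks $J$) and $M_+=\mathrm{diag}(J,\dots,J)$ (with $w/2$ blocks $J$) are $w\times w$ block-diagonal matrices. -}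

module Defs where

open import Data.Bool.Base using (Bool; true; false; if_then_else_)
import Data.Bool.Properties as Bool
open import Data.Fin.Base using (Fin; toℕ; splitAt)
import Data.Fin.Properties as Fin
open import Data.Integer.Base as ℤ using (ℤ; 0ℤ; 1ℤ; -1ℤ)
import Data.Integer.Properties as ℤ
open import Data.List.Base as List using (List; []; _∷_; _++_)
open import Data.List.Membership.Propositional using (_∈_)
open import Data.List.Membership.Propositional.Properties
  using (∈-map⁺; ∈-++⁺ˡ; ∈-++⁺ʳ; ∈-cartesianProduct⁺; ∈-allFin)
open import Data.List.Relation.Unary.Any using (here; there)
open import Data.Nat.Base using (ℕ; zero; suc; _+_; _∸_; _<_; ⌊_/2⌋; parity)
import Data.Nat.Properties as ℕ
open import Data.Parity.Base using (Parity; 0ℙ; 1ℙ)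
import Data.Parity.Properties as Parity
open import Data.Product.Base using (_×_; _,_; uncurry)
open import Data.Sum.Base using (_⊎_; inj₁; inj₂)
open import Data.Vec.Base as Vec using (Vec; lookup)
open import Data.Vec.Functional using (Vector)
open import Level using (0ℓ)
open import Relation.Binary.Core using (Rel)
open import Relation.Binary.Construct.Closure.Equivalence using (EqClosure)
open import Relation.Binary.Construct.Closure.ReflexiveTransitive
  using (Star; ε; _◅_; _◅◅_)
open import Relation.Binary.Construct.Closure.Symmetric using (SymClosure; fwd; bwd)
open import Relation.Binary.Construct.Union using (_∪_) renaming (decidable to ∪-decidable)
open import Relation.Binary.Definitions using (Decidable; DecidableEquality)
open import Relation.Binary.PropositionalEquality using (_≡_; refl)
open import Relation.Nullary.Decidable
  using (Dec; yes; no; does; map′; _×-dec_; _⊎-dec_)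

open import Algebra.Properties.CommutativeMonoid.Sum ℤ.+-0-commutativeMonoid
  using (sum-syntax)

Even Odd : ℕ → Set
Even n = parity n ≡ 0ℙ
Odd  n = parity n ≡ 1ℙ

------------------------------------------------------------------------
-- Hammock networks

data NetworkType : Set where
  first second : NetworkType

wireParity : NetworkType → Parity
wireParity first  = 0ℙ
wireParity second = 1ℙ

-- Points before any identification: the two terminals and the two ends
-- of each relay c i j.
data Point (l w : ℕ) : Set where
  S T        : Point l w
  left right : (i : Fin l) (j : Fin w) → Point l w

-- Generators of the identification of points.  For i ≥ 1 the node (i , j)
-- is the common class of right (i-1) j and left i j.
data Identified (ty : NetworkType) {l w : ℕ} : Rel (Point l w) 0ℓ where
  source   : ∀ {i j} → toℕ i ≡ 0 → Identified ty S (left i j)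
  terminus : ∀ {i j} → suc (toℕ i) ≡ l → Identified ty (right i j) T
  series   : ∀ {i i′ j} → toℕ i′ ≡ suc (toℕ i) → Identified ty (right i j) (left i′ j)
  wire     : ∀ {i j j′} → 0 < toℕ i → toℕ j′ ≡ suc (toℕ j) →
             parity (toℕ i + toℕ j) ≡ wireParity ty →
             Identified ty (left i j) (left i j′)

-- Entry (i , j) is true when relay c i j is closed.
State : (l w : ℕ) → Set
State l w = Vec (Vec Bool w) l

data ClosedRelay {l w : ℕ} (s : State l w) : Rel (Point l w) 0ℓ where
  relay : ∀ {i j} → lookup (lookup s i) j ≡ true → ClosedRelay s (left i j) (right i j)

-- Connectivity in the quotient by the identifications is the equivalence
-- closure of the identifications together with the closed relays.
Connected : NetworkType → ∀ {l w} → State l w → Rel (Point l w) 0ℓ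
Connected ty s = EqClosure (Identified ty ∪ ClosedRelay s)

Closed : NetworkType → ∀ {l w} → State l w → Set
Closed ty s = Connected ty s S T

------------------------------------------------------------------------
-- Decidability of Closed

-- Over a type enumerated by a list, Star R is decided by the
-- Floyd–Warshall recursion on the list of allowed intermediate vertices.
module Reachability {A : Set} {R : Rel A 0ℓ} (_≟_ : DecidableEquality A)
                    (R? : Decidable R) where

  Reach : List A → A → A → Set
  Reach []       x y = x ≡ y ⊎ R x y
  Reach (z ∷ zs) x y = Reach zs x y ⊎ (Reach zs x z × Reach zs z y)

  reach? : ∀ zs → Decidable (Reach zs)
  reach? []       x y = (x ≟ y) ⊎-dec R? x y
  reach? (z ∷ zs) x y = reach? zs x y ⊎-dec (reach? zs x z ×-dec reach? zs z y)

  sound : ∀ zs {x y} → Reach zs x y → Star R x y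
  sound []       (inj₁ refl)    = ε
  sound []       (inj₂ r)       = r ◅ ε
  sound (z ∷ zs) (inj₁ p)       = sound zs p
  sound (z ∷ zs) (inj₂ (p , q)) = sound zs p ◅◅ sound zs q

  refl-reach : ∀ zs {x} → Reach zs x x
  refl-reach []       = inj₁ refl
  refl-reach (_ ∷ zs) = inj₁ (refl-reach zs)

  step-reach : ∀ zs {x y} → R x y → Reach zs x y
  step-reach []       r = inj₂ r
  step-reach (_ ∷ zs) r = inj₁ (step-reach zs r)

  to-head : ∀ {z} zs {x} → Reach (z ∷ zs) x z → Reach zs x z
  to-head zs (inj₁ p)       = p
  to-head zs (inj₂ (p , _)) = p

  from-head : ∀ {z} zs {y} → Reach (z ∷ zs) z y → Reach zs z y
  from-head zs (inj₁ q)       = q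
  from-head zs (inj₂ (_ , q)) = q

  trans-reach : ∀ {zs x y z} → z ∈ zs → Reach zs x z → Reach zs z y → Reach zs x y
  trans-reach {_ ∷ zs} (here refl) p q = inj₂ (to-head zs p , from-head zs q)
  trans-reach (there m) (inj₁ p)       (inj₁ q)       = inj₁ (trans-reach m p q)
  trans-reach (there m) (inj₁ p)       (inj₂ (q , r)) = inj₂ (trans-reach m p q , r)
  trans-reach (there m) (inj₂ (o , p)) (inj₁ q)       = inj₂ (o , trans-reach m p q)
  trans-reach (there _) (inj₂ (o , _)) (inj₂ (_ , r)) = inj₂ (o , r)

  star? : ∀ zs → (∀ z → z ∈ zs) → Decidable (Star R)
  star? zs ∈zs x y = map′ (sound zs) complete (reach? zs x y)
    where
    complete : ∀ {x y} → Star R x y → Reach zs x y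
    complete ε        = refl-reach zs
    complete (r ◅ rs) = trans-reach (∈zs _) (step-reach zs r) (complete rs)

symClosure? : {A : Set} {R : Rel A 0ℓ} → Decidable R → Decidable (SymClosure R)
symClosure? R? x y =
  map′ (λ { (inj₁ r) → fwd r ; (inj₂ r) → bwd r })
       (λ { (fwd r) → inj₁ r ; (bwd r) → inj₂ r })
       (R? x y ⊎-dec R? y x)

module _ {l w : ℕ} where

  infix 4 _≟_

  _≟_ : DecidableEquality (Point l w)
  S ≟ S = yes refl
  S ≟ T = no λ ()
  S ≟ left _ _ = no λ ()
  S ≟ right _ _ = no λ ()
  T ≟ S = no λ ()
  T ≟ T = yes refl
  T ≟ left _ _ = no λ ()
  T ≟ right _ _ = no λ ()
  left _ _ ≟ S = no λ ()
  left _ _ ≟ T = no λ ()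
  left i j ≟ left i′ j′ =
    map′ (λ { (refl , refl) → refl }) (λ { refl → refl , refl })
         ((i Fin.≟ i′) ×-dec (j Fin.≟ j′))
  left _ _ ≟ right _ _ = no λ ()
  right _ _ ≟ S = no λ ()
  right _ _ ≟ T = no λ ()
  right _ _ ≟ left _ _ = no λ ()
  right i j ≟ right i′ j′ =
    map′ (λ { (refl , refl) → refl }) (λ { refl → refl , refl })
         ((i Fin.≟ i′) ×-dec (j Fin.≟ j′))

  relays : List (Fin l × Fin w)
  relays = List.cartesianProduct (List.allFin l) (List.allFin w)

  points : List (Point l w)
  points = S ∷ T ∷ List.map (uncurry left) relays ++ List.map (uncurry right) relays

  ∈-points : ∀ x → x ∈ points
  ∈-points S           = here refl
  ∈-points T           = there (here refl)
  ∈-points (left i j)  = there (there (∈-++⁺ˡ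
    (∈-map⁺ (uncurry left) (∈-cartesianProduct⁺ (∈-allFin i) (∈-allFin j)))))
  ∈-points (right i j) = there (there (∈-++⁺ʳ (List.map (uncurry left) relays)
    (∈-map⁺ (uncurry right) (∈-cartesianProduct⁺ (∈-allFin i) (∈-allFin j)))))

  identified? : ∀ ty → Decidable (Identified ty {l} {w})
  identified? ty S S = no λ ()
  identified? ty S T = no λ ()
  identified? ty S (left i _) = map′ source (λ { (source e) → e }) (toℕ i ℕ.≟ 0)
  identified? ty S (right _ _) = no λ ()
  identified? ty T _ = no λ ()
  identified? ty (left _ _) S = no λ ()
  identified? ty (left _ _) T = no λ ()
  identified? ty (left i j) (left i′ j′) =
    map′ (λ { (refl , p , e , q) → wire p e q }) (λ { (wire p e q) → refl , p , e , q })
         ((i Fin.≟ i′) ×-dec (0 ℕ.<? toℕ i) ×-dec (toℕ j′ ℕ.≟ suc (toℕ j))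
           ×-dec (parity (toℕ i + toℕ j) Parity.≟ wireParity ty))
  identified? ty (left _ _) (right _ _) = no λ ()
  identified? ty (right _ _) S = no λ ()
  identified? ty (right i _) T = map′ terminus (λ { (terminus e) → e }) (suc (toℕ i) ℕ.≟ l)
  identified? ty (right i j) (left i′ j′) =
    map′ (λ { (refl , e) → series e }) (λ { (series e) → refl , e })
         ((j Fin.≟ j′) ×-dec (toℕ i′ ℕ.≟ suc (toℕ i)))
  identified? ty (right _ _) (right _ _) = no λ ()

  closedRelay? : (s : State l w) → Decidable (ClosedRelay s)
  closedRelay? s S _ = no λ ()
  closedRelay? s T _ = no λ ()
  closedRelay? s (left _ _) S = no λ ()
  closedRelay? s (left _ _) T = no λ ()
  closedRelay? s (left _ _) (left _ _) = no λ ()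
  closedRelay? s (left i j) (right i′ j′) =
    map′ (λ { (refl , refl , e) → relay e }) (λ { (relay e) → refl , refl , e })
         ((i Fin.≟ i′) ×-dec (j Fin.≟ j′) ×-dec (lookup (lookup s i) j Bool.≟ true))
  closedRelay? s (right _ _) _ = no λ ()

  connected? : ∀ ty (s : State l w) → Decidable (Connected ty s)
  connected? ty s = Reachability.star? _≟_
    (symClosure? (∪-decidable (identified? ty) (closedRelay? s)))
    points ∈-points

  closed? : ∀ ty (s : State l w) → Dec (Closed ty s)
  closed? ty s = connected? ty s S T

------------------------------------------------------------------------
-- Integer polynomials in p, as coefficient lists with the constant
-- coefficient first

Poly : Set
Poly = List ℤ

coeff : Poly → ℕ → ℤ
coeff []      _       = 0ℤ
coeff (a ∷ f) zero    = a
coeff (a ∷ f) (suc k) = coeff f k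

infixl 6 _+ₚ_
infixl 7 _*ₚ_

_+ₚ_ : Poly → Poly → Poly
[]      +ₚ g       = g
(a ∷ f) +ₚ []      = a ∷ f
(a ∷ f) +ₚ (b ∷ g) = a ℤ.+ b ∷ f +ₚ g

_*ₚ_ : Poly → Poly → Poly
[]      *ₚ g = []
(a ∷ f) *ₚ g = List.map (a ℤ.*_) g +ₚ (0ℤ ∷ f *ₚ g)

-- The factors p and 1 - p.
relayProbability : Bool → Poly
relayProbability true  = 0ℤ ∷ 1ℤ ∷ []
relayProbability false = 1ℤ ∷ -1ℤ ∷ []

probability : ∀ {l w} → State l w → Poly
probability s =
  List.foldr _*ₚ_ (1ℤ ∷ []) (List.map relayProbability (Vec.toList (Vec.concat s)))

allVecs : ∀ {A : Set} → List A → ∀ n → List (Vec A n)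
allVecs xs zero    = Vec.[] ∷ []
allVecs xs (suc n) = List.cartesianProductWith Vec._∷_ xs (allVecs xs n)

allStates : ∀ l w → List (State l w)
allStates l w = allVecs (allVecs (true ∷ false ∷ []) w) l

reliability : NetworkType → ℕ → ℕ → Poly
reliability ty l w =
  List.foldr _+ₚ_ [] (List.map probability (List.filter (closed? ty) (allStates l w)))

P[_,_,_,_] : NetworkType → ℕ → ℕ → ℕ → ℤ
P[ ty , l , w , k ] = coeff (reliability ty l w) k

------------------------------------------------------------------------
-- Matrices

Matrix : ℕ → ℕ → Set
Matrix m n = Fin m → Fin n → ℤ

infixl 7 _*ₘ_
infixr 8 _^ₘ_
infixr 6 _⊕_

_*ₘ_ : ∀ {m n o} → Matrix m n → Matrix n o → Matrix m o
_*ₘ_ {n = n} A B i k = ∑[ j < n ] (A i j ℤ.* B j k)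

identity : ∀ {n} → Matrix n n
identity i j = if does (i Fin.≟ j) then 1ℤ else 0ℤ

_^ₘ_ : ∀ {n} → Matrix n n → ℕ → Matrix n n
A ^ₘ zero  = identity
A ^ₘ suc k = A *ₘ A ^ₘ k

-- x A yᵀ
⟨_∣_∣_⟩ : ∀ {m n} → Vector ℤ m → Matrix m n → Vector ℤ n → ℤ
⟨_∣_∣_⟩ {m} {n} x A y = ∑[ i < m ] (∑[ j < n ] (x i ℤ.* A i j ℤ.* y j))

-- The block-diagonal matrix diag(A, B).
_⊕_ : ∀ {m m′ n n′} → Matrix m n → Matrix m′ n′ → Matrix (m + m′) (n + n′)
_⊕_ {m} {n = n} A B i j with splitAt m i | splitAt n j
... | inj₁ a | inj₁ b = A a b
... | inj₂ a | inj₂ b = B a b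
... | inj₁ _ | inj₂ _ = 0ℤ
... | inj₂ _ | inj₁ _ = 0ℤ

J : Matrix 2 2
J _ _ = 1ℤ

one : Matrix 1 1
one _ _ = 1ℤ

-- diag(J, …, J) for even w and diag(J, …, J, 1) for odd w.
blocks : ∀ w → Matrix w w
blocks zero          = λ ()
blocks (suc zero)    = one
blocks (suc (suc w)) = J ⊕ blocks w

-- diag(1, J, …, J) for odd w and diag(1, J, …, J, 1) for even w ≥ 2.
1-blocks : ∀ w → Matrix w w
1-blocks zero    = λ ()
1-blocks (suc w) = one ⊕ blocks w

-- M-U and M-L are meant for odd w, M₊ and M₋ for even w ≥ 2.
M-U M-L M₊ M₋ : ∀ w → Matrix w w
M-U = blocks
M-L = 1-blocks
M₊  = blocks
M₋  = 1-blocks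

u v t : ∀ w → Vector ℤ w
u w j = 1ℤ
v w j = if does (suc (toℕ j) ℕ.≟ w) then 0ℤ else 1ℤ
t w j = if does (toℕ j ℕ.≟ 0) then 0ℤ else v w j

ρ : ℕ → ℕ
ρ l = ⌊ l ∸ 1 /2⌋

{-# OPTIONS --safe #-}

-- A state is closed only if every column contains a closed relay, so P_{l+1}
-- depends only on the closed states with one closed relay per column, up to one
-- column d with two, {a, b}.  A simple path from S to T crosses d an odd number
-- of times, hence once, so such a state is closed iff one of the two paths through
-- a and through b is.
-- With g(a) the indicator that the path through a is closed, inclusion–exclusion
-- makes all terms cancel except the sum of - g(a) g(b) over a < b.  As consecutive
-- columns of wires are offset, two closed paths can differ in one entry only in
-- the first or the last column, where the number of choices is a row sum of the
-- wire matrix B minus 1.  If walks n m is u Bₙ ⋯ Bₙ₊ₘ₋₁ uᵀ, this gives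
--   - P_{l+1} = 2 walks n (l-1) - walks n (l-2) - walks (n+1) (l-2),
-- and the four formulas follow by transposition, by the reflection of odd widths,
-- and from B zᵀ = 2 B uᵀ - 2 uᵀ for the pairs (B , z) that end the products.

module Submission where

open import Defs
open import Data.Bool.Base using (true; false; if_then_else_)
open import Data.Empty using (⊥; ⊥-elim)
open import Data.Fin.Base using (Fin; zero; suc; toℕ; fromℕ<; opposite)
open import Data.Fin.Permutation using (reverse)
import Data.Fin.Properties as Fin
open import Data.Fin.Subset using (Subset; ⁅_⁆; _∪_; _∈_; Nonempty; ∣_∣) renaming (⊥ to ∅; _-_ to _⟍_)
open import Data.Fin.Subset.Properties
  using (nonempty?; ∪-identityˡ; x∈⁅x⁆; x∈⁅y⁆⇒x≡y; x∈p∪q⁻; x∈p∪q⁺; x∈p⇒∣p-x∣<∣p∣)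
open import Data.Integer.Base as ℤ using (ℤ; 0ℤ; 1ℤ; -1ℤ; -_; _+_; _*_; _-_)
import Data.Integer.Properties as ℤ
open import Data.Integer.Tactic.RingSolver using (solve-∀)
open import Data.List.Base as List using (List; []; _∷_)
import Data.List.Properties as List
open import Data.Nat.Base as ℕ
  using (ℕ; zero; suc; _<_; _≤_; _∸_; _≡ᵇ_; z<s; s<s; s≤s; z≤n; ⌊_/2⌋; ⌈_/2⌉; parity)
import Data.Nat.Properties as ℕ
open import Data.Nat.Tactic.RingSolver using () renaming (solve-∀ to ℕ-solve-∀)
open import Data.Product.Base using (_×_; _,_; proj₁; proj₂; ∃)
open import Data.Rational.Base using (-½; _/_) renaming (_*_ to _*ℚ_)
import Data.Rational.Base as ℚ
import Data.Rational.Properties as ℚ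
import Data.Rational.Unnormalised.Base as ℚᵘ
import Data.Rational.Unnormalised.Properties as ℚᵘ
open import Data.Sum.Base as Sum using (_⊎_; inj₁; inj₂; [_,_]′)
open import Data.Unit.Base using (⊤; tt)
open import Data.Vec.Base as Vec using (Vec; []; _∷_; lookup; _[_]≔_)
open import Data.Vec.Functional using (Vector; transpose)
import Data.Vec.Properties as Vec
open import Function.Base using (_∘_; id; case_of_)
open import Function.Bundles using (_⇔_; mk⇔; Equivalence)
open import Level using (0ℓ)
open import Relation.Binary.Construct.Closure.Equivalence using (return)
open import Relation.Binary.Construct.Closure.ReflexiveTransitive using (ε; _◅_; _◅◅_)
open import Relation.Binary.Construct.Closure.Symmetric using (fwd; bwd)
open import Relation.Binary.Definitions using (tri<; tri≈; tri>)
open import Relation.Binary.PropositionalEquality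
open import Relation.Nullary using (¬_; Dec; yes; no; does; contradiction; _×-dec_; _⊎-dec_)
open import Relation.Nullary.Decidable using (dec-true; dec-false)
open import Relation.Unary using (Pred; Decidable)

open import Algebra.Properties.Semiring.Sum ℤ.+-*-semiring
  using (sum; sum-cong-≗; sum-replicate-zero; ∑-distrib-+; ∑-comm; *-distribˡ-sum; *-distribʳ-sum; sum-permute)

open ≡-Reasoning
open Equivalence using (to; from)

-- That a closed state has a closed path through `a` or `b` is proved without simple paths. If
-- neither path is closed, one exhibits a set of nodes that contains S but not T and is respected by
-- all identifications and closed relays. It is glued at column d from a set on the levels up to d
-- and another on the levels beyond. The converse builds the connection explicitly. The decision
-- procedure behind `closed?` is never unfolded: it enters only through equivalences of
-- propositions. Wires enter only through equality of blocks. This makes the two network types a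
-- single family shifted by `offset`, in which the index matters modulo 2 only, so that every
-- product met later alternates between two symmetric matrices.

private variable
  A A′ A″ : Set
  k l m n w : ℕ

-- Connectivity

-- At level k the wires join h and h + 1 exactly when offset ty + k + h is even,
-- so that (k , h) and (k , h′) are the same node iff h and h′ have the same
-- block (offset ty + k).
block : ℕ → ℕ → ℕ
block n h = ⌊ n ℕ.+ h /2⌋

offset : NetworkType → ℕ
offset first  = 0
offset second = 1

⌊/2⌋-injective-up-to-pairs : ∀ a b → ⌊ a /2⌋ ≡ ⌊ b /2⌋ →
  a ≡ b ⊎ (Even a × b ≡ suc a) ⊎ (Even b × a ≡ suc b)
⌊/2⌋-injective-up-to-pairs zero          zero          _ = inj₁ refl
⌊/2⌋-injective-up-to-pairs zero          (suc zero)    _ = inj₂ (inj₁ (refl , refl))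
⌊/2⌋-injective-up-to-pairs (suc zero)    zero          _ = inj₂ (inj₂ (refl , refl))
⌊/2⌋-injective-up-to-pairs (suc zero)    (suc zero)    _ = inj₁ refl
⌊/2⌋-injective-up-to-pairs (suc (suc a)) (suc (suc b)) e
  with ⌊/2⌋-injective-up-to-pairs a b (ℕ.suc-injective e)
... | inj₁ refl               = inj₁ refl
... | inj₂ (inj₁ (p , refl)) = inj₂ (inj₁ (p , refl))
... | inj₂ (inj₂ (p , refl)) = inj₂ (inj₂ (p , refl))

⌊/2⌋-even : ∀ n → Even n → ⌊ n /2⌋ ≡ ⌊ suc n /2⌋
⌊/2⌋-even zero          _ = refl
⌊/2⌋-even (suc (suc n)) p = cong suc (⌊/2⌋-even n p)

odd⇔suc-even : ∀ n → Odd n ⇔ Even (suc n)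
odd⇔suc-even zero          = mk⇔ (λ ()) (λ ())
odd⇔suc-even (suc zero)    = mk⇔ (λ _ → refl) (λ _ → refl)
odd⇔suc-even (suc (suc n)) = odd⇔suc-even n

wireParity⇔even : ∀ ty n → parity n ≡ wireParity ty ⇔ Even (offset ty ℕ.+ n)
wireParity⇔even first  n = mk⇔ id id
wireParity⇔even second n = odd⇔suc-even n

Wired : NetworkType → ℕ → ℕ → ℕ → Set
Wired ty k h h′ = block (offset ty ℕ.+ k) h ≡ block (offset ty ℕ.+ k) h′

block-assoc : ∀ ty k h → block (offset ty ℕ.+ k) h ≡ ⌊ offset ty ℕ.+ (k ℕ.+ h) /2⌋
block-assoc ty k h = cong ⌊_/2⌋ (ℕ.+-assoc (offset ty) k h)

module _ {l w : ℕ} where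

  -- S and T have no height of their own; 0 is an arbitrary choice, since the sets used as
  -- invariants do not depend on the height at levels 0 and `l`. A right end is put one level up, so
  -- that the two points of `series` get the same coordinates.
  level height : Point l w → ℕ
  level S           = 0
  level T           = l
  level (left i _)  = toℕ i
  level (right i _) = suc (toℕ i)
  height S           = 0
  height T           = 0
  height (left _ j)  = toℕ j
  height (right _ j) = toℕ j

module _ (ty : NetworkType) {l w : ℕ} (s : State l w) where

  -- `Column` selects the columns of relays that `X` must respect: each half of a cut at column d is
  -- constrained only by the relays on its own side of d.
  record Stable (Column : ℕ → Set) (X : ℕ → ℕ → Set) : Set where
    field
      wired   : ∀ {k h h′} → Wired ty k h h′ → X k h → X k h′
      relayed : ∀ {i j} → Column (toℕ i) → lookup (lookup s i) j ≡ true →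
                X (toℕ i) (toℕ j) ⇔ X (suc (toℕ i)) (toℕ j)

  open Stable

  stable-const : ∀ {Column} A → Stable Column (λ _ _ → A)
  stable-const A .wired _     = id
  stable-const A .relayed _ _ = mk⇔ id id

  stable-¬ : ∀ {Column X} → Stable Column X → Stable Column (λ k h → ¬ X k h)
  stable-¬ st .wired e ¬x     = ¬x ∘ st .wired (sym e)
  stable-¬ st .relayed c p    = mk⇔ (_∘ st .relayed c p .from) (_∘ st .relayed c p .to)

  wire⇒wired : ∀ {k h h′} → h′ ≡ suc h → parity (k ℕ.+ h) ≡ wireParity ty → Wired ty k h h′
  wire⇒wired {k} {h} refl p = begin
    block (offset ty ℕ.+ k) h         ≡⟨ block-assoc ty k h ⟩
    ⌊ offset ty ℕ.+ (k ℕ.+ h) /2⌋     ≡⟨ ⌊/2⌋-even _ (wireParity⇔even ty _ .to p) ⟩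
    ⌊ suc (offset ty ℕ.+ (k ℕ.+ h)) /2⌋
      ≡⟨ cong ⌊_/2⌋ (trans (cong suc (sym (ℕ.+-assoc (offset ty) k h))) (sym (ℕ.+-suc _ h))) ⟩
    block (offset ty ℕ.+ k) (suc h)   ∎

  module _ (I : ℕ → ℕ → Set) (stable : Stable (λ _ → ⊤) I)
           (start : ∀ {h h′} → I 0 h → I 0 h′) (end : ∀ {h h′} → I l h → I l h′) where

    private
      Inv : Point l w → Set
      Inv x = I (level x) (height x)

    identified⇒⇔ : ∀ {x y} → Identified ty x y → Inv x ⇔ Inv y
    identified⇒⇔ (source e)   rewrite e = mk⇔ start start
    identified⇒⇔ (terminus e) rewrite e = mk⇔ end end
    identified⇒⇔ (series e)   rewrite e = mk⇔ id id
    identified⇒⇔ (wire _ e p) =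
      mk⇔ (stable .wired (wire⇒wired e p)) (stable .wired (sym (wire⇒wired e p)))

    step⇒⇔ : ∀ {x y} → Identified ty x y ⊎ ClosedRelay s x y → Inv x ⇔ Inv y
    step⇒⇔ (inj₁ r)         = identified⇒⇔ r
    step⇒⇔ (inj₂ (relay p)) = stable .relayed tt p

    invariant : ∀ {x y} → Connected ty s x y → Inv x → Inv y
    invariant ε           = id
    invariant (fwd r ◅ p) = invariant p ∘ step⇒⇔ r .to
    invariant (bwd r ◅ p) = invariant p ∘ step⇒⇔ r .from

  -- The region is cut at column d: it is L at the levels up to d and R beyond.
  closed⇒cut : ∀ (d : Fin l) {L R} → Stable (_< toℕ d) L → Stable (toℕ d <_) R →
    (∀ {h h′} → L 0 h → L 0 h′) → (∀ {h h′} → R l h → R l h′) →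
    (∀ {j} → lookup (lookup s d) j ≡ true → L (toℕ d) (toℕ j) ⇔ R (suc (toℕ d)) (toℕ j)) →
    Closed ty s → L 0 0 → R l 0
  closed⇒cut d {L} {R} stL stR start end mid c L00
    with invariant I stI start′ end′ c (inj₁ (ℕ.z≤n , L00))
    where
    I : ℕ → ℕ → Set
    I k h = (k ≤ toℕ d × L k h) ⊎ (toℕ d < k × R k h)

    low : ∀ {k h} → k ≤ toℕ d → I k h → L k h
    low p (inj₁ (_ , x)) = x
    low p (inj₂ (q , _)) = contradiction p (ℕ.<⇒≱ q)

    high : ∀ {k h} → toℕ d < k → I k h → R k h
    high p (inj₁ (q , _)) = contradiction q (ℕ.<⇒≱ p)
    high p (inj₂ (_ , x)) = x

    start′ : ∀ {h h′} → I 0 h → I 0 h′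
    start′ x = inj₁ (ℕ.z≤n , start (low ℕ.z≤n x))

    end′ : ∀ {h h′} → I l h → I l h′
    end′ x = inj₂ (Fin.toℕ<n d , end (high (Fin.toℕ<n d) x))

    stI : Stable (λ _ → ⊤) I
    stI .wired e (inj₁ (p , x)) = inj₁ (p , stL .wired e x)
    stI .wired e (inj₂ (p , x)) = inj₂ (p , stR .wired e x)
    stI .relayed {i} _ p with ℕ.<-cmp (toℕ i) (toℕ d)
    ... | tri< i<d _ _ = mk⇔
      (λ x → inj₁ (i<d , stL .relayed i<d p .to (low (ℕ.<⇒≤ i<d) x)))
      (λ x → inj₁ (ℕ.<⇒≤ i<d , stL .relayed i<d p .from (low i<d x)))
    ... | tri≈ _ i≡d _ with refl ← Fin.toℕ-injective i≡d = mk⇔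
      (λ x → inj₂ (ℕ.≤-refl , mid p .to (low ℕ.≤-refl x)))
      (λ x → inj₁ (ℕ.≤-refl , mid p .from (high ℕ.≤-refl x)))
    ... | tri> _ _ d<i = mk⇔
      (λ x → inj₂ (ℕ.m≤n⇒m≤1+n d<i , stR .relayed d<i p .to (high d<i x)))
      (λ x → inj₂ (d<i , stR .relayed d<i p .from (high (ℕ.m≤n⇒m≤1+n d<i) x)))
  ... | inj₁ (p , _) = contradiction p (ℕ.<⇒≱ (Fin.toℕ<n d))
  ... | inj₂ (_ , x) = x

  -- At an empty column all levels up to `i` can be cut off from the rest. Hence every column of a
  -- closed state contributes at least one factor p.
  closed⇒nonempty : Closed ty s → ∀ i → Nonempty (lookup s i)
  closed⇒nonempty c i with nonempty? (lookup s i)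
  ... | yes p = p
  ... | no ¬p = ⊥-elim
    (closed⇒cut i (stable-const ⊤) (stable-const ⊥) id id
      (λ p → contradiction (_ , Vec.lookup⇒[]= _ _ p) ¬p) c tt)

  wired⇒connected : ∀ {i j j′} → 0 < toℕ i → Wired ty (toℕ i) (toℕ j) (toℕ j′) →
                    Connected ty s (left i j) (left i j′)
  wired⇒connected {i} {j} {j′} 0<i e
    with ⌊/2⌋-injective-up-to-pairs _ _
           (trans (sym (block-assoc ty (toℕ i) (toℕ j))) (trans e (block-assoc ty (toℕ i) (toℕ j′))))
  ... | inj₁ q with refl ← Fin.toℕ-injective
                              (ℕ.+-cancelˡ-≡ (toℕ i) _ _ (ℕ.+-cancelˡ-≡ (offset ty) _ _ q)) = ε
  ... | inj₂ pairs = [ (λ (p , q) → fwd (joined p q) ◅ ε) , (λ (p , q) → bwd (joined p q) ◅ ε) ]′ pairs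
    where
    joined : ∀ {a b} → Even (offset ty ℕ.+ (toℕ i ℕ.+ toℕ a)) →
             offset ty ℕ.+ (toℕ i ℕ.+ toℕ b) ≡ suc (offset ty ℕ.+ (toℕ i ℕ.+ toℕ a)) →
             Identified ty (left i a) (left i b) ⊎ ClosedRelay s (left i a) (left i b)
    joined p q = inj₁ (wire 0<i
      (ℕ.+-cancelˡ-≡ (toℕ i) _ _ (ℕ.+-cancelˡ-≡ (offset ty) _ _
        (trans q (trans (sym (ℕ.+-suc (offset ty) _)) (cong (offset ty ℕ.+_) (sym (ℕ.+-suc (toℕ i) _)))))))
      (wireParity⇔even ty _ .from p))

-- Connectivity through a path: Reaches k h says that the path Y leads from S
-- to the node (k , h), and Continues n k h that it leads from (k , h) to the
-- terminus n levels further.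
module Path (ty : NetworkType) (Y : ℕ → ℕ) where

  Reaches : ℕ → ℕ → Set
  Reaches zero    _ = ⊤
  Reaches (suc k) h = Reaches k (Y k) × Wired ty (suc k) (Y k) h

  Continues : ℕ → ℕ → ℕ → Set
  Continues zero    _ _ = ⊤
  Continues (suc n) k h = Wired ty k h (Y k) × Continues n (suc k) (Y k)

  reaches? : ∀ k h → Dec (Reaches k h)
  reaches? zero    _ = yes tt
  reaches? (suc k) h = reaches? k (Y k) ×-dec (_ ℕ.≟ _)

  continues? : ∀ n k h → Dec (Continues n k h)
  continues? zero    _ _ = yes tt
  continues? (suc n) k h = (_ ℕ.≟ _) ×-dec continues? n (suc k) (Y k)

  module _ (l : ℕ) where

    Leaves : ℕ → ℕ → Set
    Leaves k h = Continues (l ∸ k) k h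

    -- `Reaches d` consults `Y` only below d and `Leaves (suc d)` only beyond d, so `h` takes the
    -- place of `Y d`.
    Through : ℕ → ℕ → Set
    Through d h = Reaches d h × Leaves (suc d) h

  module _ {l w : ℕ} (y : Fin l → Fin w) (Y≡y : ∀ i → Y (toℕ i) ≡ toℕ (y i))
           (s : State l w) (d : Fin l) where

    module _ (only : ∀ {i j} → toℕ i ≢ toℕ d → lookup (lookup s i) j ≡ true → j ≡ y i) where

      private
        only-Y : ∀ {i j} → toℕ i ≢ toℕ d → lookup (lookup s i) j ≡ true → Y (toℕ i) ≡ toℕ j
        only-Y {i} i≢d p = trans (Y≡y i) (cong toℕ (sym (only i≢d p)))

      reaches-stable : Stable ty s (_< toℕ d) Reaches
      reaches-stable .Stable.wired {zero}  _ _       = tt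
      reaches-stable .Stable.wired {suc k} e (r , q) = r , trans q e
      reaches-stable .Stable.relayed {i} {j} i<d p
        with only-Y {i} {j} (ℕ.<⇒≢ i<d) p
      ... | eq rewrite eq = mk⇔ (_, refl) proj₁

      leaves-stable : Stable ty s (toℕ d <_) (Leaves l)
      leaves-stable .Stable.wired {k} e c with l ∸ k
      ... | zero  = tt
      ... | suc n = trans (sym e) (proj₁ c) , proj₂ c
      leaves-stable .Stable.relayed {i} {j} d<i p
        -- For i < l, `l ∸ i` is the successor of `l ∸ suc i`; exposing it lets `Continues` take its
        -- step at column `i`.
        with l ∸ toℕ i | ℕ.+-∸-assoc 1 (Fin.toℕ<n i) | only-Y {i} {j} (≢-sym (ℕ.<⇒≢ d<i)) p
      ... | _ | refl | eq rewrite eq = mk⇔ proj₂ (refl ,_)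

      module _ (a b : Fin w)
               (atMost : ∀ {j} → lookup (lookup s d) j ≡ true → j ≡ a ⊎ j ≡ b) where

        private
          In Out : Fin w → Set
          In  j = Reaches (toℕ d) (toℕ j)
          Out j = Leaves l (suc (toℕ d)) (toℕ j)

          end : ∀ {h h′} → ¬ Leaves l l h → ¬ Leaves l l h′
          end ¬x x rewrite ℕ.n∸n≡0 l = ¬x tt

          leaves-end : ∀ {h} → Leaves l l h
          leaves-end rewrite ℕ.n∸n≡0 l = tt

          both : {P Q : Fin w → Set} → (P a ⇔ Q a) → (P b ⇔ Q b) →
                 ∀ {j} → lookup (lookup s d) j ≡ true → P j ⇔ Q j
          both pa pb p with atMost p
          ... | inj₁ refl = pa
          ... | inj₂ refl = pb

          neither : {A B : Set} → ¬ A → ¬ B → A ⇔ B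
          neither ¬a ¬b = mk⇔ (λ a → contradiction a ¬a) (λ b → contradiction b ¬b)

          always : {A B : Set} → A → B → A ⇔ B
          always a b = mk⇔ (λ _ → b) (λ _ → a)

          unreached : Closed ty s → ¬ (¬ In a × ¬ In b)
          unreached c (¬a , ¬b) = closed⇒cut ty s d reaches-stable (stable-const ty s ⊥) id id
            (both {In} {λ _ → ⊥} (neither ¬a id) (neither ¬b id)) c tt

          unleft : Closed ty s → ¬ (¬ Out a × ¬ Out b)
          unleft c (¬a , ¬b) = closed⇒cut ty s d (stable-const ty s ⊤) (stable-¬ ty s leaves-stable) id end
            (both {λ _ → ⊤} {λ j → ¬ Out j} (always tt ¬a) (always tt ¬b)) c tt leaves-end

          -- Meant for the case that one relay is reached but does not lead on to T, while the other
          -- leads on but is not reached. With `Reaches` on the left and the complement of `Leaves`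
          -- on the right, the first relay has both ends in the set and the second has none.
          crossed : Closed ty s → (In a ⇔ (¬ Out a)) → (In b ⇔ (¬ Out b)) → ⊥
          crossed c pa pb = closed⇒cut ty s d reaches-stable (stable-¬ ty s leaves-stable) id end
            (both {In} {λ j → ¬ Out j} pa pb) c tt leaves-end

        closed⇒through : Closed ty s → Through l (toℕ d) (toℕ a) ⊎ Through l (toℕ d) (toℕ b)
        closed⇒through c
          with reaches? (toℕ d) (toℕ a) | continues? (l ∸ suc (toℕ d)) (suc (toℕ d)) (toℕ a)
             | reaches? (toℕ d) (toℕ b) | continues? (l ∸ suc (toℕ d)) (suc (toℕ d)) (toℕ b)
        ... | yes ia | yes oa | _      | _      = inj₁ (ia , oa)
        ... | _      | _      | yes ib | yes ob = inj₂ (ib , ob)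
        ... | no ¬ia | _      | no ¬ib | _      = ⊥-elim (unreached c (¬ia , ¬ib))
        ... | _      | no ¬oa | _      | no ¬ob = ⊥-elim (unleft c (¬oa , ¬ob))
        ... | yes ia | no ¬oa | no ¬ib | yes ob =
          ⊥-elim (crossed c (always ia ¬oa) (neither ¬ib (λ ¬ob → ¬ob ob)))
        ... | no ¬ia | yes oa | yes ib | no ¬ob =
          ⊥-elim (crossed c (neither ¬ia (λ ¬oa → ¬oa oa)) (always ib ¬ob))

    module _ (closed : ∀ {i} → toℕ i ≢ toℕ d → lookup (lookup s i) (y i) ≡ true) where

      reaches⇒connected : ∀ k {i j} → toℕ i ≡ k → k ≤ toℕ d → Reaches k (toℕ j) →
                          Connected ty s S (left i j)
      reaches⇒connected zero    e _ _ = return (inj₁ (source e))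
      reaches⇒connected (suc k) {i} {j} e k<d (r , q) =
        reaches⇒connected k e′ (ℕ.<⇒≤ k<d) (subst (Reaches k) (Yk k e′) r)
          ◅◅ fwd (inj₂ (relay (closed (λ eq → ℕ.<⇒≢ k<d (trans (sym e′) eq)))))
           ◅ fwd (inj₁ (series (trans e (cong suc (sym e′)))))
           ◅ wired⇒connected ty s (subst (0 <_) (sym e) z<s)
               (subst₂ (λ m z → Wired ty m z (toℕ j)) (sym e) (Yk k e′) q)
        where
        k<l : k < l
        k<l = ℕ.<-trans k<d (Fin.toℕ<n d)
        e′ : toℕ (fromℕ< k<l) ≡ k
        e′ = Fin.toℕ-fromℕ< k<l
        Yk : ∀ k {i} → toℕ i ≡ k → Y k ≡ toℕ (y i)
        Yk _ refl = Y≡y _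

      continues⇒connected : ∀ n {i j} → suc (toℕ i) ℕ.+ n ≡ l → toℕ d ≤ toℕ i →
        Continues n (suc (toℕ i)) (toℕ j) → Connected ty s (right i j) T
      continues⇒connected zero    e _ _ = return (inj₁ (terminus (trans (sym (ℕ.+-identityʳ _)) e)))
      continues⇒connected (suc n) {i} {j} e d≤i (q , c) =
        fwd (inj₁ (series e′))
          ◅ wired⇒connected ty s (subst (0 <_) (sym e′) z<s)
              (subst₂ (λ m z → Wired ty m (toℕ j) z) (sym e′) Yi q)
         ◅◅ fwd (inj₂ (relay (closed (≢-sym (ℕ.<⇒≢ (subst (toℕ d <_) (sym e′) (s<s d≤i)))))))
          ◅ continues⇒connected n
              (trans (cong (λ m → suc m ℕ.+ n) e′) (trans (sym (ℕ.+-suc _ n)) e))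
              (ℕ.≤-trans (ℕ.m≤n⇒m≤1+n d≤i) (ℕ.≤-reflexive (sym e′)))
              (subst₂ (λ m z → Continues n (suc m) z) (sym e′) Yi c)
        where
        i<l : suc (toℕ i) < l
        i<l = subst (suc (toℕ i) <_) e (ℕ.m<m+n _ z<s)
        i′ : Fin l
        i′ = fromℕ< i<l
        e′ : toℕ i′ ≡ suc (toℕ i)
        e′ = Fin.toℕ-fromℕ< i<l
        Yi : Y (suc (toℕ i)) ≡ toℕ (y i′)
        Yi = trans (cong Y (sym e′)) (Y≡y i′)

      through⇒closed : ∀ {a} → lookup (lookup s d) a ≡ true →
                       Through l (toℕ d) (toℕ a) → Closed ty s
      through⇒closed {a} p (r , c) =
        reaches⇒connected (toℕ d) refl ℕ.≤-refl r
          ◅◅ fwd (inj₂ (relay p))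
           ◅ continues⇒connected (l ∸ suc (toℕ d)) (ℕ.m+[n∸m]≡n (Fin.toℕ<n d)) ℕ.≤-refl c

-- Sums over states and paths

listSum : (A → ℤ) → List A → ℤ
listSum f []       = 0ℤ
listSum f (x ∷ xs) = f x + listSum f xs

listSum-cong : {f g : A → ℤ} → (∀ x → f x ≡ g x) → ∀ xs → listSum f xs ≡ listSum g xs
listSum-cong e []       = refl
listSum-cong e (x ∷ xs) = cong₂ _+_ (e x) (listSum-cong e xs)

listSum-zero : {f : A → ℤ} → (∀ x → f x ≡ 0ℤ) → ∀ xs → listSum f xs ≡ 0ℤ
listSum-zero e []       = refl
listSum-zero e (x ∷ xs) = cong₂ _+_ (e x) (listSum-zero e xs)

listSum-+ : (f g : A → ℤ) → ∀ xs → listSum (λ x → f x + g x) xs ≡ listSum f xs + listSum g xs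
listSum-+ f g []       = refl
listSum-+ f g (x ∷ xs) = trans (cong (f x + g x +_) (listSum-+ f g xs)) (lemma (f x) (g x) _ _)
  where
  lemma : ∀ a b c d → a + b + (c + d) ≡ a + c + (b + d)
  lemma = solve-∀

listSum-* : ∀ k (f : A → ℤ) xs → listSum (λ x → k * f x) xs ≡ k * listSum f xs
listSum-* k f []       = sym (ℤ.*-zeroʳ k)
listSum-* k f (x ∷ xs) = trans (cong (k * f x +_) (listSum-* k f xs)) (sym (ℤ.*-distribˡ-+ k (f x) _))

listSum-++ : ∀ (f : A → ℤ) xs ys → listSum f (xs List.++ ys) ≡ listSum f xs + listSum f ys
listSum-++ f []       ys = sym (ℤ.+-identityˡ _)
listSum-++ f (x ∷ xs) ys = trans (cong (f x +_) (listSum-++ f xs ys)) (sym (ℤ.+-assoc (f x) _ _))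

listSum-map : ∀ (f : A′ → ℤ) (g : A → A′) xs → listSum f (List.map g xs) ≡ listSum (f ∘ g) xs
listSum-map f g []       = refl
listSum-map f g (x ∷ xs) = cong (f (g x) +_) (listSum-map f g xs)

listSum-product : ∀ (f : A″ → ℤ) (g : A → A′ → A″) xs ys →
  listSum f (List.cartesianProductWith g xs ys) ≡ listSum (λ x → listSum (λ y → f (g x y)) ys) xs
listSum-product f g []       ys = refl
listSum-product f g (x ∷ xs) ys = begin
  listSum f (List.map (g x) ys List.++ List.cartesianProductWith g xs ys)
    ≡⟨ listSum-++ f (List.map (g x) ys) _ ⟩
  listSum f (List.map (g x) ys) + listSum f (List.cartesianProductWith g xs ys)
    ≡⟨ cong₂ _+_ (listSum-map f (g x) ys) (listSum-product f g xs ys) ⟩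
  listSum (f ∘ g x) ys + listSum (λ x → listSum (λ y → f (g x y)) ys) xs ∎

listSum-∑ : ∀ (f : A → Vector ℤ n) xs →
            listSum (λ x → sum (f x)) xs ≡ sum (λ i → listSum (λ x → f x i) xs)
listSum-∑ {n = n} f [] = sym (sum-replicate-zero n)
listSum-∑ f (x ∷ xs) = trans (cong (sum (f x) +_) (listSum-∑ f xs)) (sym (∑-distrib-+ (f x) (λ i → listSum (λ x → f x i) xs)))

listSum-filter : ∀ {P : Pred A 0ℓ} (P? : Decidable P) (f : A → ℤ) xs →
  listSum f (List.filter P? xs) ≡ listSum (λ x → f x * (if does (P? x) then 1ℤ else 0ℤ)) xs
listSum-filter P? f []       = refl
listSum-filter P? f (x ∷ xs) with does (P? x)
... | true  = cong₂ _+_ (sym (ℤ.*-identityʳ (f x))) (listSum-filter P? f xs)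
... | false = trans (listSum-filter P? f xs)
  (trans (sym (ℤ.+-identityˡ _)) (cong (_+ _) (sym (ℤ.*-zeroʳ (f x)))))

pathSum : ∀ l → (Vec (Fin w) l → ℤ) → ℤ
pathSum zero    f = f []
pathSum (suc l) f = sum (λ a → pathSum l (λ y → f (a ∷ y)))

pathSum-cong : ∀ l {f g : Vec (Fin w) l → ℤ} → (∀ y → f y ≡ g y) → pathSum l f ≡ pathSum l g
pathSum-cong zero    e = e []
pathSum-cong (suc l) e = sum-cong-≗ (λ a → pathSum-cong l (λ y → e (a ∷ y)))

pathSum-* : ∀ l k (f : Vec (Fin w) l → ℤ) → pathSum l (λ y → k * f y) ≡ k * pathSum l f
pathSum-* zero    k f = refl
pathSum-* {w} (suc l) k f = trans (sum-cong-≗ {w} (λ a → pathSum-* l k (λ y → f (a ∷ y))))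
  (sym (*-distribˡ-sum {w} k (λ a → pathSum l (λ y → f (a ∷ y)))))

pathSum-zero : ∀ l {f : Vec (Fin w) l → ℤ} → (∀ y → f y ≡ 0ℤ) → pathSum l f ≡ 0ℤ
pathSum-zero     zero    e = e []
pathSum-zero {w} (suc l) e =
  trans (sum-cong-≗ (λ a → pathSum-zero l (λ y → e (a ∷ y)))) (sum-replicate-zero w)

listSum-pathSum : ∀ l (f : A → Vec (Fin w) l → ℤ) xs →
  listSum (λ x → pathSum l (f x)) xs ≡ pathSum l (λ y → listSum (λ x → f x y) xs)
listSum-pathSum zero    f xs = refl
listSum-pathSum {w = w} (suc l) f xs = trans (listSum-∑ (λ x a → pathSum l (λ y → f x (a ∷ y))) xs)
  (sum-cong-≗ {w} (λ a → listSum-pathSum l (λ x y → f x (a ∷ y)) xs))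

-- The second elementary symmetric polynomial in the values of `g`; for a {0, 1}-valued `g` it
-- counts the unordered pairs of ones.
e₂ : Vector ℤ n → ℤ
e₂ {zero}  g = 0ℤ
e₂ {suc n} g = g zero * sum (g ∘ suc) + e₂ (g ∘ suc)

e₂-cong : {f g : Vector ℤ n} → (∀ i → f i ≡ g i) → e₂ f ≡ e₂ g
e₂-cong {zero}  e = refl
e₂-cong {suc n} e = cong₂ _+_ (cong₂ _*_ (e zero) (sum-cong-≗ (e ∘ suc))) (e₂-cong (e ∘ suc))

e₂-* : ∀ k (g : Vector ℤ n) → e₂ (λ i → k * g i) ≡ k * k * e₂ g
e₂-* {zero}  k g = sym (ℤ.*-zeroʳ (k * k))
e₂-* {suc n} k g = trans
  (cong₂ _+_ (cong (k * g zero *_) (sym (*-distribˡ-sum k (g ∘ suc)))) (e₂-* k (g ∘ suc)))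
  (lemma k (g zero) (sum (g ∘ suc)) (e₂ (g ∘ suc)))
  where
  lemma : ∀ k a b c → k * a * (k * b) + k * k * c ≡ k * k * (a * b + c)
  lemma = solve-∀

sum-zero : {f : Vector ℤ n} → (∀ i → f i ≡ 0ℤ) → sum f ≡ 0ℤ
sum-zero {n} e = trans (sum-cong-≗ e) (sum-replicate-zero n)

e₂-orthogonal : (g : Vector ℤ n) → (∀ i j → i ≢ j → g i * g j ≡ 0ℤ) → e₂ g ≡ 0ℤ
e₂-orthogonal {zero}  g e = refl
e₂-orthogonal {suc n} g e = cong₂ _+_
  (trans (*-distribˡ-sum (g zero) (g ∘ suc)) (sum-zero (λ j → e zero (suc j) (λ ()))))
  (e₂-orthogonal (g ∘ suc) (λ i j i≢j → e (suc i) (suc j) (i≢j ∘ Fin.suc-injective)))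

ofSize : ℕ → Subset w → ℤ
ofSize k x = if ∣ x ∣ ≡ᵇ k then 1ℤ else 0ℤ

subsets : ∀ w → List (Subset w)
subsets = allVecs (true ∷ false ∷ [])

listSum-subsets : ∀ (f : Subset (suc w) → ℤ) → listSum f (subsets (suc w)) ≡
  listSum (f ∘ (true ∷_)) (subsets w) + listSum (f ∘ (false ∷_)) (subsets w)
listSum-subsets {w} f = trans (listSum-product f _∷_ (true ∷ false ∷ []) (subsets w))
  (cong (listSum (f ∘ (true ∷_)) (subsets w) +_) (ℤ.+-identityʳ _))

listSum-size-0 : ∀ (f : Subset w → ℤ) → listSum (λ x → ofSize 0 x * f x) (subsets w) ≡ f ∅
listSum-size-0 {zero}  f = trans (ℤ.+-identityʳ _) (ℤ.*-identityˡ _)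
listSum-size-0 {suc w} f = begin
  listSum (λ x → ofSize 0 x * f x) (subsets (suc w)) ≡⟨ listSum-subsets {w} _ ⟩
  listSum (λ x → 0ℤ * f (true ∷ x)) (subsets w)
    + listSum (λ x → ofSize 0 x * f (false ∷ x)) (subsets w)
    ≡⟨ cong₂ _+_ (listSum-zero (λ x → ℤ.*-zeroˡ (f (true ∷ x))) (subsets w)) (listSum-size-0 (f ∘ (false ∷_))) ⟩
  0ℤ + f ∅ ≡⟨ ℤ.+-identityˡ _ ⟩
  f ∅ ∎

listSum-size-1 : ∀ (f : Subset w → ℤ) →
  listSum (λ x → ofSize 1 x * f x) (subsets w) ≡ sum (λ a → f ⁅ a ⁆)
listSum-size-1 {zero}  f = trans (ℤ.+-identityʳ _) (ℤ.*-zeroˡ (f []))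
listSum-size-1 {suc w} f = trans (listSum-subsets {w} _)
  (cong₂ _+_ (listSum-size-0 (f ∘ (true ∷_))) (listSum-size-1 (f ∘ (false ∷_))))

-- Each entry lies in w - 1 of the two-element subsets, which gives the linear term; the products
-- over the pairs give `e₂`.
listSum-size-2 : ∀ (f : Subset w → ℤ) →
  (∀ a b → f (⁅ a ⁆ ∪ ⁅ b ⁆) ≡ f ⁅ a ⁆ + f ⁅ b ⁆ - f ⁅ a ⁆ * f ⁅ b ⁆) →
  listSum (λ x → ofSize 2 x * f x) (subsets w) ≡ (ℤ.+ w - 1ℤ) * sum (λ a → f ⁅ a ⁆) - e₂ (λ a → f ⁅ a ⁆)
listSum-size-2 {zero}  f _ = trans (ℤ.+-identityʳ _) (ℤ.*-zeroˡ (f []))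
listSum-size-2 {suc w} f incl-excl = begin
  listSum (λ x → ofSize 2 x * f x) (subsets (suc w))
    ≡⟨ listSum-subsets {w} _ ⟩
  listSum (λ x → ofSize 1 x * f (true ∷ x)) (subsets w)
    + listSum (λ x → ofSize 2 x * f (false ∷ x)) (subsets w)
    ≡⟨ cong₂ _+_ (listSum-size-1 (f ∘ (true ∷_)))
                 (listSum-size-2 (f ∘ (false ∷_)) (λ a b → incl-excl (suc a) (suc b))) ⟩
  sum (λ a → f (true ∷ ⁅ a ⁆)) + ((ℤ.+ w - 1ℤ) * Σg - e₂ g)
    ≡⟨ cong (_+ ((ℤ.+ w - 1ℤ) * Σg - e₂ g)) (trans (sum-cong-≗ {w} pair) (trans (∑-distrib-+ (λ _ → g₀) (λ a → (1ℤ - g₀) * g a))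
         (cong₂ _+_ (sum-const w) (sym (*-distribˡ-sum (1ℤ - g₀) g))))) ⟩
  ℤ.+ w * g₀ + (1ℤ - g₀) * Σg + ((ℤ.+ w - 1ℤ) * Σg - e₂ g)
    ≡⟨ lemma (ℤ.+ w) g₀ Σg (e₂ g) ⟩
  (1ℤ + ℤ.+ w - 1ℤ) * (g₀ + Σg) - (g₀ * Σg + e₂ g) ∎
  where
  g₀ = f ⁅ zero ⁆
  g : Vector ℤ w
  g a = f ⁅ suc a ⁆
  Σg = sum g
  pair : ∀ a → f (true ∷ ⁅ a ⁆) ≡ g₀ + (1ℤ - g₀) * g a
  pair a = begin
    f (true ∷ ⁅ a ⁆)       ≡⟨ cong (λ x → f (true ∷ x)) (sym (∪-identityˡ ⁅ a ⁆)) ⟩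
    f (true ∷ (∅ ∪ ⁅ a ⁆)) ≡⟨ incl-excl zero (suc a) ⟩
    g₀ + g a - g₀ * g a    ≡⟨ rearrange g₀ (g a) ⟩
    g₀ + (1ℤ - g₀) * g a   ∎
    where
    rearrange : ∀ x y → x + y - x * y ≡ x + (1ℤ - x) * y
    rearrange = solve-∀
  sum-const : ∀ n → sum {n} (λ _ → g₀) ≡ ℤ.+ n * g₀
  sum-const zero    = sym (ℤ.*-zeroˡ g₀)
  sum-const (suc n) = trans (cong (g₀ +_) (sum-const n)) (sym (ℤ.suc-* (ℤ.+ n) g₀))
  lemma : ∀ w g₀ σ e → w * g₀ + (1ℤ - g₀) * σ + ((w - 1ℤ) * σ - e) ≡
                       (1ℤ + w - 1ℤ) * (g₀ + σ) - (g₀ * σ + e)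
  lemma = solve-∀

-- The coefficients of p and p² in the probability of a nonempty column x are
-- ofSize 1 x and nextOrder x.
nextOrder : Subset w → ℤ
nextOrder {w} x = (1ℤ - ℤ.+ w) * ofSize 1 x + ofSize 2 x

-- A column {a} has probability p (1 - p)^(w - 1), which contributes 1 - w at p². This is opposite
-- to the number w - 1 of pairs containing `a`, so the linear terms cancel and only the products
-- over pairs survive.
listSum-nextOrder : ∀ (f : Subset w → ℤ) →
  (∀ a b → f (⁅ a ⁆ ∪ ⁅ b ⁆) ≡ f ⁅ a ⁆ + f ⁅ b ⁆ - f ⁅ a ⁆ * f ⁅ b ⁆) →
  listSum (λ x → nextOrder x * f x) (subsets w) ≡ - e₂ (λ a → f ⁅ a ⁆)
listSum-nextOrder {w} f incl-excl = begin
  listSum (λ x → nextOrder x * f x) (subsets w)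
    ≡⟨ listSum-cong (λ x → expand (1ℤ - ℤ.+ w) (ofSize 1 x) (ofSize 2 x) (f x)) (subsets w) ⟩
  listSum (λ x → (1ℤ - ℤ.+ w) * (ofSize 1 x * f x) + ofSize 2 x * f x) (subsets w)
    ≡⟨ listSum-+ (λ x → (1ℤ - ℤ.+ w) * (ofSize 1 x * f x)) (λ x → ofSize 2 x * f x) (subsets w) ⟩
  listSum (λ x → (1ℤ - ℤ.+ w) * (ofSize 1 x * f x)) (subsets w) + listSum (λ x → ofSize 2 x * f x) (subsets w)
    ≡⟨ cong₂ _+_
         (trans (listSum-* (1ℤ - ℤ.+ w) (λ x → ofSize 1 x * f x) (subsets w)) (cong ((1ℤ - ℤ.+ w) *_) (listSum-size-1 f)))
         (listSum-size-2 f incl-excl) ⟩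
  (1ℤ - ℤ.+ w) * sum g + ((ℤ.+ w - 1ℤ) * sum g - e₂ g)
    ≡⟨ cancel (ℤ.+ w) (sum g) (e₂ g) ⟩
  - e₂ g ∎
  where
  g : Vector ℤ w
  g a = f ⁅ a ⁆
  expand : ∀ c a b y → (c * a + b) * y ≡ c * (a * y) + b * y
  expand = solve-∀
  cancel : ∀ w σ e → (1ℤ - w) * σ + ((w - 1ℤ) * σ - e) ≡ - e
  cancel = solve-∀

-- The coefficients of p^l and p^(l+1) in the probability of a state of length
-- l without empty column.
leading next : State l w → ℤ
leading []      = 1ℤ
leading (x ∷ s) = ofSize 1 x * leading s
next []      = 0ℤ
next (x ∷ s) = ofSize 1 x * next s + nextOrder x * leading s

-- At order l + 1 at most one column holds two closed relays, so the law is asked for one column at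
-- a time, with singletons in all the others.
InclusionExclusion : (State l w → ℤ) → Set
InclusionExclusion {l} {w} G = ∀ (y : Vec (Fin w) l) i a b →
  let at = λ x → G (Vec.map ⁅_⁆ y [ i ]≔ x) in
  at (⁅ a ⁆ ∪ ⁅ b ⁆) ≡ at ⁅ a ⁆ + at ⁅ b ⁆ - at ⁅ a ⁆ * at ⁅ b ⁆

-- For a {0, 1}-valued g: the number of unordered pairs of paths in g that differ
-- in exactly one entry.
doubled : ∀ l → (Vec (Fin w) l → ℤ) → ℤ
doubled zero    g = 0ℤ
doubled (suc l) g = sum (λ a → doubled l (λ y → g (a ∷ y))) + pathSum l (λ y → e₂ (λ a → g (a ∷ y)))

doubled-cong : ∀ l {f g : Vec (Fin w) l → ℤ} → (∀ y → f y ≡ g y) → doubled l f ≡ doubled l g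
doubled-cong zero    e = refl
doubled-cong (suc l) e = cong₂ _+_
  (sum-cong-≗ (λ a → doubled-cong l (λ y → e (a ∷ y))))
  (pathSum-cong l (λ y → e₂-cong (λ a → e (a ∷ y))))

-- `doubled` is quadratic. When `k` is an indicator its square is `k` again, which lets the first
-- factor of `weight` be pulled out in `doubled-weight`.
doubled-* : ∀ l k (g : Vec (Fin w) l → ℤ) → doubled l (λ y → k * g y) ≡ k * k * doubled l g
doubled-* zero    k g = sym (ℤ.*-zeroʳ (k * k))
doubled-* {w} (suc l) k g = trans
  (cong₂ _+_
    (trans (sum-cong-≗ {w} (λ a → doubled-* l k (λ y → g (a ∷ y))))
           (sym (*-distribˡ-sum {w} (k * k) (λ a → doubled l (λ y → g (a ∷ y))))))
    (trans (pathSum-cong l (λ y → e₂-* k (λ a → g (a ∷ y)))) (pathSum-* l (k * k) (λ y → e₂ (λ a → g (a ∷ y))))))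
  (sym (ℤ.*-distribˡ-+ (k * k) (sum (λ a → doubled l (λ y → g (a ∷ y)))) (pathSum l (λ y → e₂ (λ a → g (a ∷ y))))))

listSum-leading : ∀ l (G : State l w → ℤ) →
  listSum (λ s → leading s * G s) (allStates l w) ≡ pathSum l (λ y → G (Vec.map ⁅_⁆ y))
listSum-leading zero    G = trans (ℤ.+-identityʳ _) (ℤ.*-identityˡ _)
listSum-leading {w} (suc l) G = begin
  listSum (λ s → leading s * G s) (allStates (suc l) w)
    ≡⟨ listSum-product _ _∷_ (subsets w) (allStates l w) ⟩
  listSum (λ x → listSum (λ s → ofSize 1 x * leading s * G (x ∷ s)) (allStates l w)) (subsets w)
    ≡⟨ listSum-cong (λ x → trans
         (listSum-cong (λ s → ℤ.*-assoc (ofSize 1 x) (leading s) (G (x ∷ s))) (allStates l w))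
         (listSum-* (ofSize 1 x) (λ s → leading s * G (x ∷ s)) (allStates l w))) (subsets w) ⟩
  listSum (λ x → ofSize 1 x * listSum (λ s → leading s * G (x ∷ s)) (allStates l w)) (subsets w)
    ≡⟨ listSum-size-1 {w} _ ⟩
  sum {w} (λ a → listSum (λ s → leading s * G (⁅ a ⁆ ∷ s)) (allStates l w))
    ≡⟨ sum-cong-≗ {w} (λ a → listSum-leading l (λ s → G (⁅ a ⁆ ∷ s))) ⟩
  pathSum (suc l) (λ y → G (Vec.map ⁅_⁆ y)) ∎

-- Product rule: the coefficient beyond the leading one is taken either in a later column, the first
-- being a singleton, or in the first, where `listSum-nextOrder` leaves `e₂`. The recursion of
-- `doubled` has the same two summands.
listSum-next : ∀ l (G : State l w → ℤ) → InclusionExclusion G →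
  listSum (λ s → next s * G s) (allStates l w) ≡ - doubled l (λ y → G (Vec.map ⁅_⁆ y))
listSum-next zero    G _  = trans (ℤ.+-identityʳ _) (ℤ.*-zeroˡ (G []))
listSum-next {w} (suc l) G ie = begin
  listSum (λ s → next s * G s) (allStates (suc l) w)
    ≡⟨ listSum-product _ _∷_ (subsets w) (allStates l w) ⟩
  listSum (λ x → listSum (λ s → (ofSize 1 x * next s + nextOrder x * leading s) * G (x ∷ s)) (allStates l w)) (subsets w)
    ≡⟨ listSum-cong split (subsets w) ⟩
  listSum (λ x → ofSize 1 x * N x + nextOrder x * L x) (subsets w)
    ≡⟨ listSum-+ (λ x → ofSize 1 x * N x) (λ x → nextOrder x * L x) (subsets w) ⟩
  listSum (λ x → ofSize 1 x * N x) (subsets w) + listSum (λ x → nextOrder x * L x) (subsets w)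
    ≡⟨ cong₂ _+_ singles doubles ⟩
  - sum D + - pathSum l E
    ≡⟨ sym (ℤ.neg-distrib-+ (sum D) (pathSum l E)) ⟩
  - (sum D + pathSum l E) ∎
  where
  N L : Subset w → ℤ
  N x = listSum (λ s → next s * G (x ∷ s)) (allStates l w)
  L x = listSum (λ s → leading s * G (x ∷ s)) (allStates l w)
  D : Vector ℤ w
  D a = doubled l (λ y → G (⁅ a ⁆ ∷ Vec.map ⁅_⁆ y))
  E : Vec (Fin w) l → ℤ
  E y = e₂ (λ a → G (⁅ a ⁆ ∷ Vec.map ⁅_⁆ y))

  split : ∀ x → listSum (λ s → (ofSize 1 x * next s + nextOrder x * leading s) * G (x ∷ s)) (allStates l w)
              ≡ ofSize 1 x * N x + nextOrder x * L x
  split x = begin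
    listSum (λ s → (ofSize 1 x * next s + nextOrder x * leading s) * G (x ∷ s)) (allStates l w)
      ≡⟨ listSum-cong (λ s → expand (ofSize 1 x) (next s) (nextOrder x) (leading s) (G (x ∷ s))) (allStates l w) ⟩
    listSum (λ s → ofSize 1 x * (next s * G (x ∷ s)) + nextOrder x * (leading s * G (x ∷ s))) (allStates l w)
      ≡⟨ listSum-+ (λ s → ofSize 1 x * (next s * G (x ∷ s))) (λ s → nextOrder x * (leading s * G (x ∷ s)))
           (allStates l w) ⟩
    listSum (λ s → ofSize 1 x * (next s * G (x ∷ s))) (allStates l w)
      + listSum (λ s → nextOrder x * (leading s * G (x ∷ s))) (allStates l w)
      ≡⟨ cong₂ _+_ (listSum-* (ofSize 1 x) (λ s → next s * G (x ∷ s)) (allStates l w))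
                   (listSum-* (nextOrder x) (λ s → leading s * G (x ∷ s)) (allStates l w)) ⟩
    ofSize 1 x * N x + nextOrder x * L x ∎
    where
    expand : ∀ a b c d g → (a * b + c * d) * g ≡ a * (b * g) + c * (d * g)
    expand = solve-∀

  neg-sum : ∀ {n} (f : Vector ℤ n) → sum (λ i → - f i) ≡ - sum f
  neg-sum f = trans (sum-cong-≗ (λ i → sym (ℤ.-1*i≡-i (f i))))
    (trans (sym (*-distribˡ-sum -1ℤ f)) (ℤ.-1*i≡-i (sum f)))

  singles : listSum (λ x → ofSize 1 x * N x) (subsets w) ≡ - sum D
  singles = begin
    listSum (λ x → ofSize 1 x * N x) (subsets w) ≡⟨ listSum-size-1 N ⟩
    sum (λ a → N ⁅ a ⁆)
      ≡⟨ sum-cong-≗ (λ a → listSum-next l (λ s → G (⁅ a ⁆ ∷ s)) (λ y i → ie (a ∷ y) (suc i))) ⟩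
    sum (λ a → - D a) ≡⟨ neg-sum D ⟩
    - sum D ∎

  neg-pathSum : ∀ (f : Vec (Fin w) l → ℤ) → pathSum l (λ y → - f y) ≡ - pathSum l f
  neg-pathSum f = trans (pathSum-cong l (λ y → sym (ℤ.-1*i≡-i (f y))))
    (trans (pathSum-* l -1ℤ f) (ℤ.-1*i≡-i (pathSum l f)))

  doubles : listSum (λ x → nextOrder x * L x) (subsets w) ≡ - pathSum l E
  doubles = begin
    listSum (λ x → nextOrder x * L x) (subsets w)
      ≡⟨ listSum-cong (λ x → trans (cong (nextOrder x *_) (listSum-leading l (λ s → G (x ∷ s))))
           (sym (pathSum-* l (nextOrder x) _))) (subsets w) ⟩
    listSum (λ x → pathSum l (λ y → nextOrder x * G (x ∷ Vec.map ⁅_⁆ y))) (subsets w)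
      ≡⟨ listSum-pathSum l _ (subsets w) ⟩
    pathSum l (λ y → listSum (λ x → nextOrder x * G (x ∷ Vec.map ⁅_⁆ y)) (subsets w))
      ≡⟨ pathSum-cong l (λ y → listSum-nextOrder (λ x → G (x ∷ Vec.map ⁅_⁆ y)) (λ a b → ie (a ∷ y) zero a b)) ⟩
    pathSum l (λ y → - E y) ≡⟨ neg-pathSum E ⟩
    - pathSum l E ∎

-- Coefficients of the reliability polynomial

coeff-+ₚ : ∀ f g k → coeff (f +ₚ g) k ≡ coeff f k + coeff g k
coeff-+ₚ []      g       k       = sym (ℤ.+-identityˡ _)
coeff-+ₚ (a ∷ f) []      k       = sym (ℤ.+-identityʳ _)
coeff-+ₚ (a ∷ f) (b ∷ g) zero    = refl
coeff-+ₚ (a ∷ f) (b ∷ g) (suc k) = coeff-+ₚ f g k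

coeff-map : ∀ a f k → coeff (List.map (a *_) f) k ≡ a * coeff f k
coeff-map a []      k       = sym (ℤ.*-zeroʳ a)
coeff-map a (b ∷ f) zero    = refl
coeff-map a (b ∷ f) (suc k) = coeff-map a f k

coeff-0∷[] : ∀ k → coeff (0ℤ ∷ []) k ≡ 0ℤ
coeff-0∷[] zero    = refl
coeff-0∷[] (suc k) = refl

coeff-linear-zero : ∀ a b f → coeff ((a ∷ b ∷ []) *ₚ f) 0 ≡ a * coeff f 0
coeff-linear-zero a b f = begin
  coeff ((a ∷ b ∷ []) *ₚ f) 0               ≡⟨ coeff-+ₚ (List.map (a *_) f) _ 0 ⟩
  coeff (List.map (a *_) f) 0 + 0ℤ          ≡⟨ ℤ.+-identityʳ _ ⟩
  coeff (List.map (a *_) f) 0               ≡⟨ coeff-map a f 0 ⟩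
  a * coeff f 0                             ∎

coeff-linear-suc : ∀ a b f k → coeff ((a ∷ b ∷ []) *ₚ f) (suc k) ≡ a * coeff f (suc k) + b * coeff f k
coeff-linear-suc a b f k = begin
  coeff ((a ∷ b ∷ []) *ₚ f) (suc k)
    ≡⟨ coeff-+ₚ (List.map (a *_) f) (0ℤ ∷ (List.map (b *_) f +ₚ (0ℤ ∷ []))) (suc k) ⟩
  coeff (List.map (a *_) f) (suc k) + coeff (List.map (b *_) f +ₚ (0ℤ ∷ [])) k
    ≡⟨ cong₂ _+_ (coeff-map a f (suc k)) (coeff-+ₚ (List.map (b *_) f) (0ℤ ∷ []) k) ⟩
  a * coeff f (suc k) + (coeff (List.map (b *_) f) k + coeff (0ℤ ∷ []) k)
    ≡⟨ cong (a * coeff f (suc k) +_) (trans (cong₂ _+_ (coeff-map b f k) (coeff-0∷[] k)) (ℤ.+-identityʳ _)) ⟩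
  a * coeff f (suc k) + b * coeff f k ∎

-- f = a pⁿ + b pⁿ⁺¹ + higher terms
record Expansion (f : Poly) (n : ℕ) (a b : ℤ) : Set where
  constructor expansion
  field
    below : ∀ k → k < n → coeff f k ≡ 0ℤ
    at    : coeff f n ≡ a
    above : coeff f (suc n) ≡ b

open Expansion

expansion-cong : ∀ {f n a a′ b b′} → a ≡ a′ → b ≡ b′ → Expansion f n a b → Expansion f n a′ b′
expansion-cong refl refl = id

-- Columns with two or more closed relays start at a higher power of p; this restates their
-- expansion one degree lower, with leading coefficient 0.
expansion-lower : ∀ {f n a b} → Expansion f (suc n) a b → Expansion f n 0ℤ a
expansion-lower {n = n} e .below k k<n = e .below k (ℕ.m<n⇒m<1+n k<n)
expansion-lower {n = n} e .at    = e .below n ℕ.≤-refl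
expansion-lower {n = n} e .above = e .at

expansion-closed : ∀ {f n a b} → Expansion f n a b → Expansion (relayProbability true *ₚ f) (suc n) a b
expansion-closed {f} {n} {a} {b} e = λ where
    .below zero    _         → coeff-linear-zero 0ℤ 1ℤ f
    .below (suc k) (s<s k<n) → trans (shift k) (e .below k k<n)
    .at                      → trans (shift n) (e .at)
    .above                   → trans (shift (suc n)) (e .above)
  where
  shift : ∀ k → coeff (relayProbability true *ₚ f) (suc k) ≡ coeff f k
  shift k = trans (coeff-linear-suc 0ℤ 1ℤ f k) (trans (ℤ.+-identityˡ _) (ℤ.*-identityˡ _))

expansion-open : ∀ {f n a b} → Expansion f n a b → Expansion (relayProbability false *ₚ f) n a (b - a)
expansion-open {f} {n} {a} {b} e = λ where
    .below k k<n → trans (difference k) (below-pred k k<n)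
    .at          → trans (difference n) (at-pred n refl)
    .above       → trans (coeff-linear-suc 1ℤ -1ℤ f n)
                     (trans (cong₂ (λ x y → 1ℤ * x + -1ℤ * y) (e .above) (e .at)) (simplify b a))
  where
  -- Coefficient k - 1, taken as 0 for k = 0, so that multiplication by 1 - p is a difference in
  -- every degree.
  previous : ℕ → ℤ
  previous zero    = 0ℤ
  previous (suc k) = coeff f k
  simplify : ∀ x y → 1ℤ * x + -1ℤ * y ≡ x - y
  simplify = solve-∀
  difference : ∀ k → coeff (relayProbability false *ₚ f) k ≡ coeff f k - previous k
  difference zero    = trans (coeff-linear-zero 1ℤ -1ℤ f) (trans (ℤ.*-identityˡ _) (sym (ℤ.+-identityʳ _)))
  difference (suc k) = trans (coeff-linear-suc 1ℤ -1ℤ f k) (simplify (coeff f (suc k)) (coeff f k))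
  below-pred : ∀ k → k < n → coeff f k - previous k ≡ 0ℤ
  below-pred zero    k<n = trans (ℤ.+-identityʳ _) (e .below zero k<n)
  below-pred (suc k) k<n = cong₂ _-_ (e .below (suc k) k<n) (e .below k (ℕ.<-trans ℕ.≤-refl k<n))
  at-pred : ∀ k → k ≡ n → coeff f k - previous k ≡ a
  at-pred zero    refl = trans (ℤ.+-identityʳ _) (e .at)
  at-pred (suc k) refl = trans (cong₂ _-_ (e .at) (e .below k ℕ.≤-refl)) (ℤ.+-identityʳ a)

columnProduct : Subset w → Poly → Poly
columnProduct x f = List.foldr _*ₚ_ f (List.map relayProbability (Vec.toList x))

-- To first order, (1 - p)^(w - |x|) is 1 + (|x| - w) p.
expansion-column : ∀ {f n a b} (x : Subset w) → Expansion f n a b →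
  Expansion (columnProduct x f) (∣ x ∣ ℕ.+ n) a (b + (ℤ.+ ∣ x ∣ - ℤ.+ w) * a)
expansion-column {a = a} {b} [] e = expansion-cong refl (simplify b a) e
  where
  simplify : ∀ b a → b ≡ b + (0ℤ - 0ℤ) * a
  simplify = solve-∀
expansion-column {suc w} {a = a} {b} (true ∷ x) e =
  expansion-cong refl (simplify b (ℤ.+ ∣ x ∣) (ℤ.+ w) a) (expansion-closed (expansion-column x e))
  where
  simplify : ∀ b k w a → b + (k - w) * a ≡ b + (1ℤ + k - (1ℤ + w)) * a
  simplify = solve-∀
expansion-column {suc w} {a = a} {b} (false ∷ x) e =
  expansion-cong refl (simplify b (ℤ.+ ∣ x ∣) (ℤ.+ w) a) (expansion-open (expansion-column x e))
  where
  simplify : ∀ b k w a → b + (k - w) * a - a ≡ b + (k - (1ℤ + w)) * a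
  simplify = solve-∀

expansion-nonempty-column : ∀ {f n a b} (x : Subset w) → Nonempty x → Expansion f n a b →
  Expansion (columnProduct x f) (suc n) (ofSize 1 x * a) (ofSize 1 x * b + nextOrder x * a)
expansion-nonempty-column {w} {a = a} {b} x ne e with ∣ x ∣ in eq | expansion-column x e
... | 0           | _  = contradiction eq (nonempty⇒∣∣≢0 x ne)
  where
  nonempty⇒∣∣≢0 : ∀ {w} (x : Subset w) → Nonempty x → ∣ x ∣ ≢ 0
  nonempty⇒∣∣≢0 x (j , j∈x) eq = ℕ.n≮0 (subst (∣ x ⟍ j ∣ <_) eq (x∈p⇒∣p-x∣<∣p∣ j∈x))
... | 1           | e′ = expansion-cong (sym (ℤ.*-identityˡ a)) (simplify (ℤ.+ w) a b) e′
  where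
  simplify : ∀ w a b → b + (1ℤ - w) * a ≡ 1ℤ * b + ((1ℤ - w) * 1ℤ + 0ℤ) * a
  simplify = solve-∀
... | 2           | e′ = expansion-cong (sym (ℤ.*-zeroˡ a)) (simplify (ℤ.+ w) a b) (expansion-lower e′)
  where
  simplify : ∀ w a b → a ≡ 0ℤ * b + ((1ℤ - w) * 0ℤ + 1ℤ) * a
  simplify = solve-∀
-- Three closed relays give a factor p³, beyond both recorded coefficients.
... | suc (suc (suc k)) | e′ =
  expansion-cong (sym (ℤ.*-zeroˡ a)) (simplify (ℤ.+ w) a b) (vanish k (expansion-lower e′))
  where
  simplify : ∀ w a b → 0ℤ ≡ 0ℤ * b + ((1ℤ - w) * 0ℤ + 0ℤ) * a
  simplify = solve-∀
  vanish : ∀ {f n b} k → Expansion f (suc (suc (k ℕ.+ n))) 0ℤ b → Expansion f (suc n) 0ℤ 0ℤ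
  vanish zero    e = expansion-lower e
  vanish (suc k) e = vanish k (expansion-lower e)

probability-∷ : ∀ (x : Subset w) (s : State l w) → probability (x ∷ s) ≡ columnProduct x (probability s)
probability-∷ x s = begin
  product (List.map relayProbability (Vec.toList (x Vec.++ Vec.concat s)))
    ≡⟨ cong (product ∘ List.map relayProbability) (Vec.toList-++ x (Vec.concat s)) ⟩
  product (List.map relayProbability (Vec.toList x List.++ Vec.toList (Vec.concat s)))
    ≡⟨ cong product (List.map-++ relayProbability (Vec.toList x) _) ⟩
  product (List.map relayProbability (Vec.toList x) List.++ List.map relayProbability (Vec.toList (Vec.concat s)))
    ≡⟨ List.foldr-++ _*ₚ_ (1ℤ ∷ []) (List.map relayProbability (Vec.toList x)) _ ⟩
  columnProduct x (probability s) ∎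
  where product = List.foldr _*ₚ_ (1ℤ ∷ [])

expansion-probability : ∀ (s : State l w) → (∀ i → Nonempty (lookup s i)) →
                        Expansion (probability s) l (leading s) (next s)
expansion-probability []      _  = expansion (λ _ ()) refl refl
expansion-probability (x ∷ s) ne rewrite probability-∷ x s =
  expansion-nonempty-column x (ne zero) (expansion-probability s (ne ∘ suc))

coeff-foldr : ∀ (f : A → Poly) xs k →
              coeff (List.foldr _+ₚ_ [] (List.map f xs)) k ≡ listSum (λ x → coeff (f x) k) xs
coeff-foldr f []       k = refl
coeff-foldr f (x ∷ xs) k = trans (coeff-+ₚ (f x) _ k) (cong (coeff (f x) k +_) (coeff-foldr f xs k))

-- Indicators of decidable propositions

𝟙 : Dec A → ℤ
𝟙 A? = if does A? then 1ℤ else 0ℤ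

𝟙-true : (A? : Dec A) → A → 𝟙 A? ≡ 1ℤ
𝟙-true A? a rewrite dec-true A? a = refl

𝟙-false : (A? : Dec A) → ¬ A → 𝟙 A? ≡ 0ℤ
𝟙-false A? ¬a rewrite dec-false A? ¬a = refl

𝟙-⇔ : (A? : Dec A) (A′? : Dec A′) → A ⇔ A′ → 𝟙 A? ≡ 𝟙 A′?
𝟙-⇔ (yes a) A′? e = sym (𝟙-true A′? (e .to a))
𝟙-⇔ (no ¬a) A′? e = sym (𝟙-false A′? (¬a ∘ e .from))

𝟙-× : (A? : Dec A) (A′? : Dec A′) → 𝟙 (A? ×-dec A′?) ≡ 𝟙 A? * 𝟙 A′?
𝟙-× (yes _) A′? = sym (ℤ.*-identityˡ _)
𝟙-× (no _)  A′? = sym (ℤ.*-zeroˡ (𝟙 A′?))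

𝟙-⊎ : (A? : Dec A) (A′? : Dec A′) → 𝟙 (A? ⊎-dec A′?) ≡ 𝟙 A? + 𝟙 A′? - 𝟙 A? * 𝟙 A′?
𝟙-⊎ (yes _) (yes _) = refl
𝟙-⊎ (yes _) (no _)  = refl
𝟙-⊎ (no _)  (yes _) = refl
𝟙-⊎ (no _)  (no _)  = refl

𝟙-idem : (A? : Dec A) → 𝟙 A? * 𝟙 A? ≡ 𝟙 A?
𝟙-idem (yes _) = refl
𝟙-idem (no _)  = refl

*-𝟙-cong : ∀ {x y} (A? : Dec A) → (A → x ≡ y) → x * 𝟙 A? ≡ y * 𝟙 A?
*-𝟙-cong         (yes a) e = cong (_* 1ℤ) (e a)
*-𝟙-cong {x = x} {y} (no _) e = trans (ℤ.*-zeroʳ x) (sym (ℤ.*-zeroʳ y))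

reliability-coeff : ∀ ty l w → InclusionExclusion (λ s → 𝟙 (closed? {l} {w} ty s)) →
  P[ ty , l , w , suc l ] ≡ - doubled l (λ y → 𝟙 (closed? {l} {w} ty (Vec.map ⁅_⁆ y)))
reliability-coeff ty l w ie = begin
  coeff (reliability ty l w) (suc l)
    ≡⟨ coeff-foldr probability (List.filter (closed? ty) (allStates l w)) (suc l) ⟩
  listSum (λ s → coeff (probability s) (suc l)) (List.filter (closed? ty) (allStates l w))
    ≡⟨ listSum-filter (closed? ty) (λ s → coeff (probability s) (suc l)) (allStates l w) ⟩
  listSum (λ s → coeff (probability s) (suc l) * 𝟙 (closed? ty s)) (allStates l w)
    ≡⟨ listSum-cong term (allStates l w) ⟩
  listSum (λ s → next s * 𝟙 (closed? ty s)) (allStates l w)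
    ≡⟨ listSum-next l (λ s → 𝟙 (closed? ty s)) ie ⟩
  - doubled l (λ y → 𝟙 (closed? ty (Vec.map ⁅_⁆ y))) ∎
  where
  -- The expansion at degree `l` is available only without empty columns; every other state has
  -- indicator 0.
  term : ∀ s → coeff (probability s) (suc l) * 𝟙 (closed? ty s) ≡ next s * 𝟙 (closed? ty s)
  term s = *-𝟙-cong (closed? ty s) (λ c → expansion-probability s (closed⇒nonempty ty s c) .above)

-- `Path` takes a total function on levels. The value 0 past the end is a filler: `Through l` at a
-- column below `l` reads only levels below `l`.
entry : Vec (Fin w) l → ℕ → ℕ
entry []      _       = 0
entry (a ∷ y) zero    = toℕ a
entry (a ∷ y) (suc k) = entry y k

entry-lookup : ∀ (y : Vec (Fin w) l) i → entry y (toℕ i) ≡ toℕ (lookup y i)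
entry-lookup (a ∷ y) zero    = refl
entry-lookup (a ∷ y) (suc i) = entry-lookup y i

-- States with one closed relay in every column but one

module _ (ty : NetworkType) {l w : ℕ} (y : Vec (Fin w) l) (d : Fin l) where

  open Path ty (entry y)

  private
    insert : Subset w → State l w
    insert x = Vec.map ⁅_⁆ y [ d ]≔ x

    lookup-d : ∀ x → lookup (insert x) d ≡ x
    lookup-d x = Vec.lookup∘update d (Vec.map ⁅_⁆ y) x

    lookup-other : ∀ x {i} → toℕ i ≢ toℕ d → lookup (insert x) i ≡ ⁅ lookup y i ⁆
    lookup-other x {i} i≢d = trans (Vec.lookup∘update′ (i≢d ∘ cong toℕ) (Vec.map ⁅_⁆ y) x) (Vec.lookup-map i ⁅_⁆ y)

    only : ∀ x {i j} → toℕ i ≢ toℕ d → lookup (lookup (insert x) i) j ≡ true → j ≡ lookup y i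
    only x {i} {j} i≢d p =
      x∈⁅y⁆⇒x≡y _ (Vec.lookup⇒[]= j _ (subst (λ z → lookup z j ≡ true) (lookup-other x i≢d) p))

    closed : ∀ x {i} → toℕ i ≢ toℕ d → lookup (lookup (insert x) i) (lookup y i) ≡ true
    closed x {i} i≢d = subst (λ z → lookup z (lookup y i) ≡ true) (sym (lookup-other x i≢d))
                         (Vec.[]=⇒lookup (x∈⁅x⁆ (lookup y i)))

    Through′ : Fin w → Set
    Through′ a = Through l (toℕ d) (toℕ a)

    through : ∀ x {a} → a ∈ x → Through′ a → Closed ty (insert x)
    through x {a} a∈x = through⇒closed (lookup y) (entry-lookup y) (insert x) d (closed x)
      (subst (λ z → lookup z a ≡ true) (sym (lookup-d x)) (Vec.[]=⇒lookup a∈x))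

  closed⇔through₂ : ∀ a b → Closed ty (insert (⁅ a ⁆ ∪ ⁅ b ⁆)) ⇔ (Through′ a ⊎ Through′ b)
  closed⇔through₂ a b = mk⇔
    (closed⇒through (lookup y) (entry-lookup y) _ d (only _) a b
      (λ {j} p → Sum.map (x∈⁅y⁆⇒x≡y a) (x∈⁅y⁆⇒x≡y b)
        (x∈p∪q⁻ ⁅ a ⁆ ⁅ b ⁆ (Vec.lookup⇒[]= j _ (subst (λ z → lookup z j ≡ true) (lookup-d _) p)))))
    [ through _ (x∈p∪q⁺ (inj₁ (x∈⁅x⁆ a))) , through _ (x∈p∪q⁺ (inj₂ (x∈⁅x⁆ b))) ]′

  closed⇔through : ∀ a → Closed ty (insert ⁅ a ⁆) ⇔ Through′ a
  closed⇔through a = mk⇔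
    (λ c → [ id , id ]′ (closed⇒through (lookup y) (entry-lookup y) _ d (only _) a a
      (λ {j} p → inj₁ (x∈⁅y⁆⇒x≡y a (Vec.lookup⇒[]= j _ (subst (λ z → lookup z j ≡ true) (lookup-d _) p)))) c))
    (through _ (x∈⁅x⁆ a))

  closed-inclusion-exclusion : ∀ a b → let G = λ x → 𝟙 (closed? ty (insert x)) in
    G (⁅ a ⁆ ∪ ⁅ b ⁆) ≡ G ⁅ a ⁆ + G ⁅ b ⁆ - G ⁅ a ⁆ * G ⁅ b ⁆
  closed-inclusion-exclusion a b = trans
    (𝟙-⇔ (closed? ty _) (closed? ty (insert ⁅ a ⁆) ⊎-dec closed? ty (insert ⁅ b ⁆)) (mk⇔
      (Sum.map (closed⇔through a .from) (closed⇔through b .from) ∘ closed⇔through₂ a b .to)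
      (closed⇔through₂ a b .from ∘ Sum.map (closed⇔through a .to) (closed⇔through b .to))))
    (𝟙-⊎ (closed? ty (insert ⁅ a ⁆)) (closed? ty (insert ⁅ b ⁆)))

module _ {w : ℕ} where

  blockMatrix : ℕ → Matrix w w
  blockMatrix n i j = 𝟙 (block n (toℕ i) ℕ.≟ block n (toℕ j))

  -- The indicator of the paths y continuing the entry a, the first wires
  -- being those of blockMatrix n.
  weight : ℕ → Fin w → Vec (Fin w) l → ℤ
  weight n a []      = 1ℤ
  weight n a (b ∷ y) = blockMatrix n a b * weight (suc n) b y

  continues-weight : ∀ ty (Y : ℕ → ℕ) k (a : Fin w) (y : Vec (Fin w) l) →
    (∀ i → Y (k ℕ.+ i) ≡ entry y i) →
    𝟙 (Path.continues? ty Y l k (toℕ a)) ≡ weight (offset ty ℕ.+ k) a y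
  continues-weight ty Y k a [] _ = refl
  continues-weight {suc l} ty Y k a (b ∷ y) e
    with Y k | trans (cong Y (sym (ℕ.+-identityʳ k))) (e 0)
  ... | _ | refl = trans
    (𝟙-× (block (offset ty ℕ.+ k) (toℕ a) ℕ.≟ block (offset ty ℕ.+ k) (toℕ b)) (Path.continues? ty Y l (suc k) (toℕ b)))
    (cong (blockMatrix (offset ty ℕ.+ k) a b *_)
      (trans (continues-weight ty Y (suc k) b y (λ i → trans (cong Y (sym (ℕ.+-suc k i))) (e (suc i))))
             (cong (λ n → weight n b y) (ℕ.+-suc (offset ty) k))))

  -- Column 0 is taken as the special one: nothing has to be reached there, and putting back `⁅ a ⁆`
  -- changes nothing. The first wires are those of level 1, whence `offset ty ℕ.+ 1`.
  closed-weight : ∀ ty (a : Fin w) (y : Vec (Fin w) l) →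
    𝟙 (closed? ty (Vec.map ⁅_⁆ (a ∷ y))) ≡ weight (offset ty ℕ.+ 1) a y
  closed-weight {l} ty a y = trans
    (𝟙-⇔ (closed? ty _) (Path.continues? ty (entry (a ∷ y)) l 1 (toℕ a))
      (mk⇔ (proj₂ ∘ closed⇔through ty (a ∷ y) zero a .to) (λ c → closed⇔through ty (a ∷ y) zero a .from (tt , c))))
    (continues-weight ty (entry (a ∷ y)) 1 a y (λ i → refl))

-- Counting walks

2ℤ : ℤ
2ℤ = ℤ.+ 2

infixr 7 _·_

_·_ : Matrix m n → Vector ℤ n → Vector ℤ m
(A · x) i = sum (λ j → A i j * x j)

·-cong : {A B : Matrix m n} {x y : Vector ℤ n} →
         (∀ i j → A i j ≡ B i j) → (∀ j → x j ≡ y j) → ∀ i → (A · x) i ≡ (B · y) i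
·-cong A≗B x≗y i = sum-cong-≗ (λ j → cong₂ _*_ (A≗B i j) (x≗y j))

·-congʳ : (A : Matrix m n) {x y : Vector ℤ n} → (∀ j → x j ≡ y j) → ∀ i → (A · x) i ≡ (A · y) i
·-congʳ A x≗y i = sum-cong-≗ (λ j → cong (A i j *_) (x≗y j))

sum-- : (f g : Vector ℤ n) → sum (λ i → f i - g i) ≡ sum f - sum g
sum-- {n} f g = begin
  sum (λ i → f i - g i)             ≡⟨ sum-cong-≗ {n} (λ i → cong (f i +_) (sym (ℤ.-1*i≡-i (g i)))) ⟩
  sum (λ i → f i + -1ℤ * g i)       ≡⟨ ∑-distrib-+ f (λ i → -1ℤ * g i) ⟩
  sum f + sum (λ i → -1ℤ * g i)     ≡⟨ cong (sum f +_) (sym (*-distribˡ-sum -1ℤ g)) ⟩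
  sum f + -1ℤ * sum g               ≡⟨ cong (sum f +_) (ℤ.-1*i≡-i (sum g)) ⟩
  sum f - sum g                     ∎

·-- : (A : Matrix m n) (x y : Vector ℤ n) → ∀ i → (A · (λ j → x j - y j)) i ≡ (A · x) i - (A · y) i
·-- A x y i = trans (sum-cong-≗ (λ j → distrib (A i j) (x j) (y j)))
                    (sum-- (λ j → A i j * x j) (λ j → A i j * y j))
  where
  distrib : ∀ a x y → a * (x - y) ≡ a * x - a * y
  distrib = solve-∀

·-scale : (A : Matrix m n) (c : ℤ) (x : Vector ℤ n) → ∀ i → (A · (λ j → c * x j)) i ≡ c * (A · x) i
·-scale A c x i = trans (sum-cong-≗ (λ j → swap (A i j) c (x j))) (sym (*-distribˡ-sum c (λ j → A i j * x j)))
  where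
  swap : ∀ a c x → a * (c * x) ≡ c * (a * x)
  swap = solve-∀

·-*ₘ : (A : Matrix l m) (B : Matrix m n) (x : Vector ℤ n) → ∀ i → ((A *ₘ B) · x) i ≡ (A · (B · x)) i
·-*ₘ {m = m} {n} A B x i = begin
  sum (λ k → sum (λ j → A i j * B j k) * x k)
    ≡⟨ sum-cong-≗ {n} (λ k → trans (*-distribʳ-sum (x k) (λ j → A i j * B j k))
         (sum-cong-≗ {m} (λ j → ℤ.*-assoc (A i j) (B j k) (x k)))) ⟩
  sum (λ k → sum (λ j → A i j * (B j k * x k)))
    ≡⟨ ∑-comm (λ k j → A i j * (B j k * x k)) ⟩
  sum (λ j → sum (λ k → A i j * (B j k * x k)))
    ≡⟨ sum-cong-≗ {m} (λ j → sym (*-distribˡ-sum (A i j) (λ k → B j k * x k))) ⟩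
  sum (λ j → A i j * sum (λ k → B j k * x k)) ∎

identity-· : (x : Vector ℤ n) → ∀ i → (identity · x) i ≡ x i
identity-· {suc n} x zero = begin
  1ℤ * x zero + sum {n} (λ j → 0ℤ * x (suc j))
    ≡⟨ cong₂ _+_ (ℤ.*-identityˡ (x zero)) (sum-zero {n} (λ j → ℤ.*-zeroˡ (x (suc j)))) ⟩
  x zero + 0ℤ ≡⟨ ℤ.+-identityʳ (x zero) ⟩
  x zero ∎
identity-· {suc n} x (suc i) = begin
  0ℤ * x zero + (identity · (x ∘ suc)) i ≡⟨ cong₂ _+_ (ℤ.*-zeroˡ (x zero)) (identity-· (x ∘ suc) i) ⟩
  0ℤ + x (suc i)                         ≡⟨ ℤ.+-identityˡ (x (suc i)) ⟩
  x (suc i)                              ∎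

⟨u∣∣⟩ : (A : Matrix m n) (y : Vector ℤ n) → ⟨ u m ∣ A ∣ y ⟩ ≡ sum (A · y)
⟨u∣∣⟩ {m} {n} A y = sum-cong-≗ {m} (λ i → sum-cong-≗ {n} (λ j → cong (_* y j) (ℤ.*-identityˡ (A i j))))

⟨u∣transpose∣u⟩ : (A : Matrix n n) → ⟨ u n ∣ transpose A ∣ u n ⟩ ≡ sum (A · u n)
⟨u∣transpose∣u⟩ {n} A = trans (⟨u∣∣⟩ (transpose A) (u n)) (∑-comm (λ i j → A j i * 1ℤ))

blockMatrix-sym : ∀ n (i j : Fin w) → blockMatrix n i j ≡ blockMatrix n j i
blockMatrix-sym n i j =
  𝟙-⇔ (block n (toℕ i) ℕ.≟ block n (toℕ j)) (block n (toℕ j) ℕ.≟ block n (toℕ i)) (mk⇔ sym sym)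

blockMatrix-period : ∀ k n (i j : Fin w) → blockMatrix (k ℕ.* 2 ℕ.+ n) i j ≡ blockMatrix n i j
blockMatrix-period zero    n i j = refl
blockMatrix-period (suc k) n i j = blockMatrix-period k n i j

sum-0* : (x : Vector ℤ n) → sum (λ i → 0ℤ * x i) ≡ 0ℤ
sum-0* x = sum-zero (λ i → ℤ.*-zeroˡ (x i))

pair-row : ∀ a b {r} → r ≡ 0ℤ → 1ℤ * a + (1ℤ * b + r) ≡ a + b
pair-row a b refl = simplify a b
  where
  simplify : ∀ a b → 1ℤ * a + (1ℤ * b + 0ℤ) ≡ a + b
  simplify = solve-∀

blockMatrix-0-zero : (x : Vector ℤ (suc (suc w))) → (blockMatrix 0 · x) zero ≡ x zero + x (suc zero)
blockMatrix-0-zero x = pair-row (x zero) (x (suc zero)) (sum-0* (λ j → x (suc (suc j))))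

blockMatrix-0-one : (x : Vector ℤ (suc (suc w))) → (blockMatrix 0 · x) (suc zero) ≡ x zero + x (suc zero)
blockMatrix-0-one x = pair-row (x zero) (x (suc zero)) (sum-0* (λ j → x (suc (suc j))))

blockMatrix-0-suc : (x : Vector ℤ (suc (suc w))) → ∀ i →
  (blockMatrix 0 · x) (suc (suc i)) ≡ (blockMatrix 0 · (λ j → x (suc (suc j)))) i
blockMatrix-0-suc x i = simplify (x zero) (x (suc zero)) ((blockMatrix 0 · (λ j → x (suc (suc j)))) i)
  where
  simplify : ∀ a b r → 0ℤ * a + (0ℤ * b + r) ≡ r
  simplify = solve-∀

blockMatrix-1-zero : (x : Vector ℤ (suc w)) → (blockMatrix 1 · x) zero ≡ x zero
blockMatrix-1-zero {w} x = begin
  1ℤ * x zero + sum {w} (λ j → 0ℤ * x (suc j)) ≡⟨ cong₂ _+_ (ℤ.*-identityˡ (x zero)) (sum-0* (x ∘ suc)) ⟩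
  x zero + 0ℤ                                  ≡⟨ ℤ.+-identityʳ (x zero) ⟩
  x zero                                       ∎

blockMatrix-1-suc : (x : Vector ℤ (suc w)) → ∀ i → (blockMatrix 1 · x) (suc i) ≡ (blockMatrix 0 · (x ∘ suc)) i
blockMatrix-1-suc x i = simplify (x zero) ((blockMatrix 0 · (x ∘ suc)) i)
  where
  simplify : ∀ a r → 0ℤ * a + r ≡ r
  simplify = solve-∀

e₂-zero : {g : Vector ℤ n} → (∀ i → g i ≡ 0ℤ) → e₂ g ≡ 0ℤ
e₂-zero {g = g} e = e₂-orthogonal g (λ i j _ → trans (cong (_* g j) (e i)) (ℤ.*-zeroˡ (g j)))

-- A row of blockMatrix has one or two entries 1.
e₂-blockMatrix : ∀ n (a : Fin w) → e₂ (blockMatrix n a) ≡ sum (blockMatrix n a) - 1ℤ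
e₂-blockMatrix {suc zero}    zero zero = refl
e₂-blockMatrix {suc (suc w)} zero zero = begin
  1ℤ * (1ℤ + z) + (1ℤ * z + e₂ {w} (λ _ → 0ℤ)) ≡⟨ cong₂ (λ z e → 1ℤ * (1ℤ + z) + (1ℤ * z + e)) z≡0 (e₂-zero {w} (λ _ → refl)) ⟩
  1ℤ                                           ≡⟨ cong (λ z → 1ℤ + (1ℤ + z) - 1ℤ) (sym z≡0) ⟩
  1ℤ + (1ℤ + z) - 1ℤ                           ∎
  where
  z = sum {w} (λ _ → 0ℤ)
  z≡0 = sum-zero {w} (λ _ → refl)
-- Entries 0 and 1 form a block, so their rows agree by computation.
e₂-blockMatrix {suc (suc w)} zero (suc zero) = e₂-blockMatrix zero (zero {suc w})
e₂-blockMatrix {suc (suc w)} zero (suc (suc a)) = begin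
  0ℤ * (0ℤ + σ) + (0ℤ * σ + e₂ r) ≡⟨ cong (λ e → 0ℤ * (0ℤ + σ) + (0ℤ * σ + e)) (e₂-blockMatrix zero a) ⟩
  0ℤ * (0ℤ + σ) + (0ℤ * σ + (σ - 1ℤ)) ≡⟨ simplify σ ⟩
  0ℤ + (0ℤ + σ) - 1ℤ ∎
  where
  r = blockMatrix zero a
  σ = sum r
  simplify : ∀ s → 0ℤ * (0ℤ + s) + (0ℤ * s + (s - 1ℤ)) ≡ 0ℤ + (0ℤ + s) - 1ℤ
  simplify = solve-∀
e₂-blockMatrix {suc w} (suc zero) zero = begin
  1ℤ * z + e₂ {w} (λ _ → 0ℤ) ≡⟨ cong₂ (λ z e → 1ℤ * z + e) z≡0 (e₂-zero {w} (λ _ → refl)) ⟩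
  0ℤ                         ≡⟨ cong (λ z → 1ℤ + z - 1ℤ) (sym z≡0) ⟩
  1ℤ + z - 1ℤ                ∎
  where
  z = sum {w} (λ _ → 0ℤ)
  z≡0 = sum-zero {w} (λ _ → refl)
e₂-blockMatrix {suc w} (suc zero) (suc a) = begin
  0ℤ * σ + e₂ r     ≡⟨ cong (0ℤ * σ +_) (e₂-blockMatrix zero a) ⟩
  0ℤ * σ + (σ - 1ℤ) ≡⟨ simplify σ ⟩
  0ℤ + σ - 1ℤ       ∎
  where
  r = blockMatrix zero a
  σ = sum r
  simplify : ∀ s → 0ℤ * s + (s - 1ℤ) ≡ 0ℤ + s - 1ℤ
  simplify = solve-∀
e₂-blockMatrix (suc (suc n)) a = e₂-blockMatrix n a

-- The blocks of b in two consecutive partitions are ⌊ n + b /2⌋ and ⌈ n + b /2⌉,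
-- which determine b.
blockMatrix-offset : ∀ n (a b b′ c : Fin w) → b ≢ b′ →
  blockMatrix n a b * blockMatrix n a b′ * (blockMatrix (suc n) b c * blockMatrix (suc n) b′ c) ≡ 0ℤ
blockMatrix-offset n a b b′ c b≢b′ = begin
  𝟙 ab * 𝟙 ab′ * (𝟙 bc * 𝟙 b′c)                ≡⟨ cong₂ _*_ (sym (𝟙-× ab ab′)) (sym (𝟙-× bc b′c)) ⟩
  𝟙 (ab ×-dec ab′) * 𝟙 (bc ×-dec b′c)          ≡⟨ sym (𝟙-× (ab ×-dec ab′) (bc ×-dec b′c)) ⟩
  𝟙 ((ab ×-dec ab′) ×-dec (bc ×-dec b′c))      ≡⟨ 𝟙-false ((ab ×-dec ab′) ×-dec (bc ×-dec b′c)) (λ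
    ((p , q) , r , s) → b≢b′ (Fin.toℕ-injective (ℕ.+-cancelˡ-≡ n _ _ (halves (trans (sym p) q) (trans r (sym s)))))) ⟩
  0ℤ                                           ∎
  where
  ab  = block n (toℕ a) ℕ.≟ block n (toℕ b)
  ab′ = block n (toℕ a) ℕ.≟ block n (toℕ b′)
  bc  = block (suc n) (toℕ b) ℕ.≟ block (suc n) (toℕ c)
  b′c = block (suc n) (toℕ b′) ℕ.≟ block (suc n) (toℕ c)
  halves : ∀ {a b} → ⌊ a /2⌋ ≡ ⌊ b /2⌋ → ⌈ a /2⌉ ≡ ⌈ b /2⌉ → a ≡ b
  halves {a} {b} p q = trans (sym (ℕ.⌊n/2⌋+⌈n/2⌉≡n a)) (trans (cong₂ ℕ._+_ p q) (ℕ.⌊n/2⌋+⌈n/2⌉≡n b))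

-- The product of the `m` consecutive wire matrices from index `n` on, kept in applied form so that
-- no reassociation of matrix products arises.
chain : ℕ → ℕ → Vector ℤ w → Vector ℤ w
chain n zero    x = x
chain n (suc m) x = blockMatrix n · chain (suc n) m x

walks : ∀ w → ℕ → ℕ → ℤ
walks w n m = sum (chain n m (u w))

weight-idem : ∀ n (a : Fin w) (y : Vec (Fin w) l) → weight n a y * weight n a y ≡ weight n a y
weight-idem n a []      = refl
weight-idem n a (b ∷ y) = begin
  p * q * (p * q) ≡⟨ interchange p q ⟩
  p * p * (q * q) ≡⟨ cong₂ _*_ (𝟙-idem (block n (toℕ a) ℕ.≟ block n (toℕ b))) (weight-idem (suc n) b y) ⟩
  p * q           ∎
  where
  p = blockMatrix n a b
  q = weight (suc n) b y
  interchange : ∀ p q → p * q * (p * q) ≡ p * p * (q * q)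
  interchange = solve-∀

pathSum-weight : ∀ l n (a : Fin w) → pathSum l (weight n a) ≡ chain n l (u w) a
pathSum-weight     zero    n a = refl
pathSum-weight {w} (suc l) n a = sum-cong-≗ {w} (λ b → trans
  (pathSum-* l (blockMatrix n a b) (weight (suc n) b))
  (cong (blockMatrix n a b *_) (pathSum-weight l (suc n) b)))

-- The first entry `a` is held fixed, so only the last column offers a choice: a path ending in c
-- has as many pairs of extensions as the row sum at c minus 1. Changes in the first column are
-- counted separately, in `coefficient-walks`.
doubled-weight : ∀ l n (a : Fin w) →
  doubled (suc l) (weight n a) ≡ chain n (suc l) (u w) a - chain n l (u w) a
doubled-weight {w} zero n a = begin
  sum {w} (λ _ → 0ℤ) + e₂ (λ b → blockMatrix n a b * 1ℤ)
    ≡⟨ cong₂ _+_ (sum-zero {w} (λ _ → refl)) (e₂-cong (λ b → ℤ.*-identityʳ (blockMatrix n a b))) ⟩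
  0ℤ + e₂ (blockMatrix n a)      ≡⟨ ℤ.+-identityˡ (e₂ (blockMatrix n a)) ⟩
  e₂ (blockMatrix n a)           ≡⟨ e₂-blockMatrix n a ⟩
  sum (blockMatrix n a) - 1ℤ     ≡⟨ cong (_- 1ℤ) (sum-cong-≗ {w} (λ b → sym (ℤ.*-identityʳ (blockMatrix n a b)))) ⟩
  (blockMatrix n · u w) a - 1ℤ   ∎
doubled-weight {w} (suc l) n a = begin
  sum (λ b → doubled (suc l) (λ y → B b * weight (suc n) b y)) + pathSum (suc l) (λ y → e₂ (λ b → B b * weight (suc n) b y))
    ≡⟨ cong₂ _+_ (sum-cong-≗ {w} first-column) (pathSum-zero (suc l) inner-column) ⟩
  sum (λ b → B b * (X b - Y b)) + 0ℤ ≡⟨ ℤ.+-identityʳ _ ⟩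
  sum (λ b → B b * (X b - Y b)) ≡⟨ ·-- (blockMatrix n) X Y a ⟩
  (blockMatrix n · X) a - (blockMatrix n · Y) a ∎
  where
  B X Y : Vector ℤ w
  B = blockMatrix n a
  X = chain (suc n) (suc l) (u w)
  Y = chain (suc n) l (u w)
  first-column : ∀ b → doubled (suc l) (λ y → B b * weight (suc n) b y) ≡ B b * (X b - Y b)
  first-column b = trans (doubled-* (suc l) (B b) (weight (suc n) b))
    (cong₂ _*_ (𝟙-idem (block n (toℕ a) ℕ.≟ block n (toℕ b))) (doubled-weight l (suc n) b))
  inner-column : ∀ (y : Vec (Fin w) (suc l)) → e₂ (λ b → B b * weight (suc n) b y) ≡ 0ℤ
  inner-column (c ∷ y) = e₂-orthogonal _ (λ b b′ b≢b′ → begin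
    B b * (C b * r) * (B b′ * (C b′ * r)) ≡⟨ interchange (B b) (C b) (B b′) (C b′) r ⟩
    B b * B b′ * (C b * C b′) * (r * r)   ≡⟨ cong (_* (r * r)) (blockMatrix-offset n a b b′ c b≢b′) ⟩
    0ℤ * (r * r)                          ≡⟨ ℤ.*-zeroˡ (r * r) ⟩
    0ℤ                                    ∎)
    where
    C : Vector ℤ w
    C b = blockMatrix (suc n) b c
    r = weight (suc (suc n)) c y
    interchange : ∀ b c b′ c′ r → b * (c * r) * (b′ * (c′ * r)) ≡ b * b′ * (c * c′) * (r * r)
    interchange = solve-∀

-- With l = m + 2 there are m + 1 levels of wires. The first difference counts the pairs of paths
-- that differ in the last column, the second those that differ in the first; dropping that column
-- drops one matrix from the corresponding end.
coefficient-walks : ∀ ty m w → let ν = offset ty ℕ.+ 1 in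
  P[ ty , 2 ℕ.+ m , w , 3 ℕ.+ m ] ≡
  - (walks w ν (suc m) - walks w ν m + (walks w ν (suc m) - walks w (suc ν) m))
coefficient-walks ty m w = begin
  P[ ty , 2 ℕ.+ m , w , 3 ℕ.+ m ]
    ≡⟨ reliability-coeff ty (2 ℕ.+ m) w (closed-inclusion-exclusion ty) ⟩
  - doubled (2 ℕ.+ m) C
    ≡⟨ cong -_ (doubled-cong (2 ℕ.+ m) {C} {W} (λ where (a ∷ y) → closed-weight ty a y)) ⟩
  - (sum {w} (λ a → doubled (suc m) (weight ν a)) + pathSum {w} (suc m) (λ y → e₂ {w} (λ a → weight ν a y)))
    ≡⟨ cong -_ (cong₂ _+_ first-part second-part) ⟩
  - (walks w ν (suc m) - walks w ν m + (walks w ν (suc m) - walks w (suc ν) m)) ∎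
  where
  ν = offset ty ℕ.+ 1
  C W : Vec (Fin w) (2 ℕ.+ m) → ℤ
  C y = 𝟙 (closed? ty (Vec.map ⁅_⁆ y))
  W (a ∷ y) = weight ν a y
  B : Matrix w w
  B = blockMatrix ν
  X : Vector ℤ w
  X = chain (suc ν) m (u w)

  first-part : sum {w} (λ a → doubled (suc m) (weight ν a)) ≡ walks w ν (suc m) - walks w ν m
  first-part = trans (sum-cong-≗ {w} (doubled-weight m ν)) (sum-- (chain ν (suc m) (u w)) (chain ν m (u w)))

  column : ∀ c (y : Vec (Fin w) m) →
           e₂ (λ a → B a c * weight (suc ν) c y) ≡ (sum (B c) - 1ℤ) * weight (suc ν) c y
  column c y = begin
    e₂ (λ a → B a c * r)   ≡⟨ e₂-cong (λ a → trans (ℤ.*-comm (B a c) r) (cong (r *_) (blockMatrix-sym ν a c))) ⟩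
    e₂ (λ a → r * B c a)   ≡⟨ e₂-* r (B c) ⟩
    r * r * e₂ (B c)       ≡⟨ cong₂ _*_ (weight-idem (suc ν) c y) (e₂-blockMatrix ν c) ⟩
    r * (sum (B c) - 1ℤ)   ≡⟨ ℤ.*-comm r (sum (B c) - 1ℤ) ⟩
    (sum (B c) - 1ℤ) * r   ∎
    where r = weight (suc ν) c y

  second-part : pathSum {w} (suc m) (λ y → e₂ {w} (λ a → weight ν a y)) ≡ walks w ν (suc m) - walks w (suc ν) m
  second-part = begin
    sum {w} (λ c → pathSum m (λ y → e₂ (λ a → B a c * weight (suc ν) c y)))
      ≡⟨ sum-cong-≗ {w} (λ c → trans (pathSum-cong m (column c))
           (trans (pathSum-* m (sum (B c) - 1ℤ) (weight (suc ν) c))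
                  (cong ((sum (B c) - 1ℤ) *_) (pathSum-weight m (suc ν) c)))) ⟩
    sum (λ c → (sum (B c) - 1ℤ) * X c)
      ≡⟨ sum-cong-≗ {w} (λ c → trans (expand (sum (B c)) (X c)) (cong (_- X c) (*-distribʳ-sum (X c) (B c)))) ⟩
    sum (λ c → sum (λ a → B c a * X c) - X c)
      ≡⟨ sum-- (λ c → sum (λ a → B c a * X c)) X ⟩
    sum (λ c → sum (λ a → B c a * X c)) - sum X
      -- By symmetry of `B`, summing over the free first entry amounts to applying `B`.
      ≡⟨ cong (_- sum X) (trans (∑-comm (λ c a → B c a * X c))
           (sum-cong-≗ {w} (λ a → sum-cong-≗ {w} (λ c → cong (_* X c) (blockMatrix-sym ν c a))))) ⟩
    sum (B · X) - sum X ∎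
    where
    expand : ∀ s x → (s - 1ℤ) * x ≡ s * x - x
    expand = solve-∀

-- Period, transposition and reflection of the products

chain-cong : ∀ n m {x y : Vector ℤ w} → (∀ j → x j ≡ y j) → ∀ i → chain n m x i ≡ chain n m y i
chain-cong n zero    e = e
chain-cong n (suc m) e = ·-congʳ (blockMatrix n) (chain-cong (suc n) m e)

-- Raising the index by 2 adds one to every block, and the test for equality strips the successors:
-- the matrices agree by computation.
chain-period : ∀ n m (x : Vector ℤ w) → ∀ i → chain (2 ℕ.+ n) m x i ≡ chain n m x i
chain-period n zero    x i = refl
chain-period n (suc m) x   = ·-congʳ (blockMatrix n) (chain-period (suc n) m x)

walks-period : ∀ w n m → walks w (2 ℕ.+ n) m ≡ walks w n m
walks-period w n m = sum-cong-≗ (chain-period n m (u w))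

-- After an even number of factors the alternation is back at `n`, so this pair of matrices
-- continues it at the far end.
chain-append : ∀ k n (x : Vector ℤ w) → ∀ i →
  chain n (k ℕ.* 2) (blockMatrix n · blockMatrix (suc n) · x) i ≡ chain n (suc k ℕ.* 2) x i
chain-append zero    n x i = refl
chain-append (suc k) n x   =
  ·-congʳ (blockMatrix n) (·-congʳ (blockMatrix (suc n)) (chain-append k (2 ℕ.+ n) x))

dot : Vector ℤ w → Vector ℤ w → ℤ
dot x y = sum (λ i → x i * y i)

dot-· : ∀ n (x y : Vector ℤ w) → dot x (blockMatrix n · y) ≡ dot (blockMatrix n · x) y
dot-· {w} n x y = begin
  sum (λ i → x i * sum (λ j → B i j * y j))
    ≡⟨ sum-cong-≗ {w} (λ i → *-distribˡ-sum (x i) (λ j → B i j * y j)) ⟩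
  sum (λ i → sum (λ j → x i * (B i j * y j)))
    ≡⟨ ∑-comm (λ i j → x i * (B i j * y j)) ⟩
  sum (λ j → sum (λ i → x i * (B i j * y j)))
    ≡⟨ sum-cong-≗ {w} (λ j → trans
         (sum-cong-≗ {w} (λ i → trans (rearrange (x i) (B i j) (y j)) (cong (λ b → b * x i * y j) (blockMatrix-sym n i j))))
         (sym (*-distribʳ-sum (y j) (λ i → B j i * x i)))) ⟩
  sum (λ j → sum (λ i → B j i * x i) * y j) ∎
  where
  B : Matrix w w
  B = blockMatrix n
  rearrange : ∀ x b y → x * (b * y) ≡ b * x * y
  rearrange = solve-∀

-- Moving symmetric factors across the product reverses them, and an alternating product of even
-- length read backwards starts with the other matrix.
dot-chain : ∀ k n (x y : Vector ℤ w) → dot x (chain n (k ℕ.* 2) y) ≡ dot (chain (suc n) (k ℕ.* 2) x) y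
dot-chain     zero    n x y = refl
dot-chain {w} (suc k) n x y = begin
  dot x (B n · B (suc n) · Y)                   ≡⟨ dot-· n x (B (suc n) · Y) ⟩
  dot (B n · x) (B (suc n) · Y)                 ≡⟨ dot-· (suc n) (B n · x) Y ⟩
  dot X (chain (2 ℕ.+ n) (k ℕ.* 2) y)           ≡⟨ dot-chain k (2 ℕ.+ n) X y ⟩
  dot (chain (3 ℕ.+ n) (k ℕ.* 2) X) y           ≡⟨ sum-cong-≗ {w} (λ i → cong (_* y i)
    (trans (chain-period (suc n) (k ℕ.* 2) X i) (chain-append k (suc n) x i))) ⟩
  dot (chain (suc n) (suc k ℕ.* 2) x) y         ∎
  where
  B : ℕ → Matrix w w
  B = blockMatrix
  X Y : Vector ℤ w
  X = B (suc n) · B n · x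
  Y = chain (2 ℕ.+ n) (k ℕ.* 2) y

-- Transposition reverses the order of the factors.
walks-reverse : ∀ w n k → walks w (suc n) (k ℕ.* 2) ≡ walks w n (k ℕ.* 2)
walks-reverse w n k = begin
  sum (chain (suc n) (k ℕ.* 2) (u w))         ≡⟨ sum-cong-≗ {w} (λ i → sym (ℤ.*-identityʳ _)) ⟩
  dot (chain (suc n) (k ℕ.* 2) (u w)) (u w)   ≡⟨ sym (dot-chain k n (u w) (u w)) ⟩
  dot (u w) (chain n (k ℕ.* 2) (u w))         ≡⟨ sum-cong-≗ {w} (λ i → ℤ.*-identityˡ _) ⟩
  sum (chain n (k ℕ.* 2) (u w))               ∎

even-double : ∀ m → Even m → ∃ λ k → m ≡ k ℕ.* 2
even-double zero          _ = 0 , refl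
even-double (suc (suc m)) p with k , refl ← even-double m p = suc k , refl

odd-double : ∀ m → Odd m → ∃ λ k → m ≡ suc (k ℕ.* 2)
odd-double (suc zero)    _ = 0 , refl
odd-double (suc (suc m)) p with k , refl ← odd-double m p = suc k , refl

-- `a` and `b` have the same parity, so rounding one half down and the other up compensates.
halves-of-even-sum : ∀ a b k → a ℕ.+ b ≡ k ℕ.* 2 → ⌊ a /2⌋ ℕ.+ ⌈ b /2⌉ ≡ k
halves-of-even-sum zero          zero                zero    e = refl
halves-of-even-sum zero          (suc (suc b))       (suc k) e =
  cong suc (halves-of-even-sum zero b k (ℕ.suc-injective (ℕ.suc-injective e)))
halves-of-even-sum (suc zero)    (suc zero)          (suc k) e =
  cong suc (halves-of-even-sum zero zero k (ℕ.suc-injective (ℕ.suc-injective e)))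
halves-of-even-sum (suc zero)    (suc (suc b))       (suc k) e =
  cong suc (halves-of-even-sum (suc zero) b k (ℕ.suc-injective (ℕ.suc-injective e)))
halves-of-even-sum (suc (suc a)) b                   (suc k) e =
  cong suc (halves-of-even-sum a b k (ℕ.suc-injective (ℕ.suc-injective e)))

-- For w = 2k + 1, the block of `opposite i` at index n and the block of `i` at index n + 1 add up
-- to the constant n + k (`total`). So `opposite` carries one partition to the other.
blockMatrix-opposite : Odd w → ∀ n (i j : Fin w) →
                       blockMatrix n (opposite i) (opposite j) ≡ blockMatrix (suc n) i j
blockMatrix-opposite {w} odd n i j with k , refl ← odd-double w odd =
  𝟙-⇔ (block n (toℕ (opposite i)) ℕ.≟ block n (toℕ (opposite j)))
      (block (suc n) (toℕ i) ℕ.≟ block (suc n) (toℕ j))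
      (mk⇔ (λ e → ℕ.+-cancelˡ-≡ (block n (toℕ (opposite i))) _ _
                    (trans (total i) (sym (trans (cong (ℕ._+ block (suc n) (toℕ j)) e) (total j)))))
           (λ e → ℕ.+-cancelʳ-≡ (block (suc n) (toℕ i)) _ _
                    (trans (total i) (sym (trans (cong (block n (toℕ (opposite j)) ℕ.+_) e) (total j))))))
  where
  total : ∀ (i : Fin (suc (k ℕ.* 2))) → block n (toℕ (opposite i)) ℕ.+ block (suc n) (toℕ i) ≡ n ℕ.+ k
  total i = halves-of-even-sum (n ℕ.+ toℕ (opposite i)) (n ℕ.+ toℕ i) (n ℕ.+ k) (begin
    n ℕ.+ o ℕ.+ (n ℕ.+ toℕ i)        ≡⟨ interchange n o (toℕ i) ⟩
    n ℕ.* 2 ℕ.+ (o ℕ.+ toℕ i)        ≡⟨ cong (λ o → n ℕ.* 2 ℕ.+ (o ℕ.+ toℕ i)) (Fin.opposite-prop i) ⟩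
    n ℕ.* 2 ℕ.+ (k ℕ.* 2 ∸ toℕ i ℕ.+ toℕ i)
      ≡⟨ cong (n ℕ.* 2 ℕ.+_) (ℕ.m∸n+n≡m (ℕ.s≤s⁻¹ (Fin.toℕ<n i))) ⟩
    n ℕ.* 2 ℕ.+ k ℕ.* 2              ≡⟨ sym (ℕ.*-distribʳ-+ 2 n k) ⟩
    (n ℕ.+ k) ℕ.* 2                  ∎)
    where
    o = toℕ (opposite i)
    interchange : ∀ n o i → n ℕ.+ o ℕ.+ (n ℕ.+ i) ≡ n ℕ.* 2 ℕ.+ (o ℕ.+ i)
    interchange = ℕ-solve-∀

sum-opposite : ∀ (f : Vector ℤ w) → sum f ≡ sum (f ∘ opposite)
sum-opposite f = sum-permute f reverse

chain-opposite : Odd w → ∀ n m (i : Fin w) → chain n m (u w) (opposite i) ≡ chain (suc n) m (u w) i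
chain-opposite     odd n zero    i = refl
chain-opposite {w} odd n (suc m) i = begin
  sum (λ j → blockMatrix n (opposite i) j * chain (suc n) m (u w) j)
    ≡⟨ sum-opposite (λ j → blockMatrix n (opposite i) j * chain (suc n) m (u w) j) ⟩
  sum (λ j → blockMatrix n (opposite i) (opposite j) * chain (suc n) m (u w) (opposite j))
    ≡⟨ sum-cong-≗ {w} (λ j → cong₂ _*_ (blockMatrix-opposite odd n i j) (chain-opposite odd (suc n) m j)) ⟩
  sum (λ j → blockMatrix (suc n) i j * chain (2 ℕ.+ n) m (u w) j) ∎

-- For odd w, reflecting the network exchanges the two types.
walks-reflect : ∀ w → Odd w → ∀ n m → walks w n m ≡ walks w 0 m
walks-reflect w odd zero    m = refl
walks-reflect w odd (suc n) m = begin
  sum (chain (suc n) m (u w))            ≡⟨ sum-cong-≗ {w} (λ i → sym (chain-opposite odd n m i)) ⟩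
  sum (chain n m (u w) ∘ opposite)       ≡⟨ sym (sum-opposite (chain n m (u w))) ⟩
  sum (chain n m (u w))                  ≡⟨ walks-reflect w odd n m ⟩
  walks w 0 m                            ∎

-- The vectors that end the products

-- z is such that half of blockMatrix n · z is the indicator of the positions
-- in the blocks J.
Halving : ℕ → Vector ℤ w → Set
Halving {w} n z = ∀ i → (blockMatrix n · z) i ≡ 2ℤ * (blockMatrix n · u w) i - 2ℤ * u w i

-- `m ℕ.+ n` is the index of the last of the `suc m` factors; the factors before it act linearly on
-- its relation.
chain-halving : ∀ n m (z : Vector ℤ w) → Halving (m ℕ.+ n) z → ∀ i →
  chain n (suc m) z i ≡ 2ℤ * chain n (suc m) (u w) i - 2ℤ * chain n m (u w) i
chain-halving n zero    z h i = h i
chain-halving {w} n (suc m) z h i = begin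
  (B · chain (suc n) (suc m) z) i
    ≡⟨ ·-congʳ B (chain-halving (suc n) m z (subst (λ p → Halving p z) (sym (ℕ.+-suc m n)) h)) i ⟩
  (B · (λ j → 2ℤ * X j - 2ℤ * Y j)) i ≡⟨ ·-- B (λ j → 2ℤ * X j) (λ j → 2ℤ * Y j) i ⟩
  (B · (λ j → 2ℤ * X j)) i - (B · (λ j → 2ℤ * Y j)) i
    ≡⟨ cong₂ _-_ (·-scale B 2ℤ X i) (·-scale B 2ℤ Y i) ⟩
  2ℤ * (B · X) i - 2ℤ * (B · Y) i ∎
  where
  B : Matrix w w
  B = blockMatrix n
  X Y : Vector ℤ w
  X = chain (suc n) (suc m) (u w)
  Y = chain (suc n) m (u w)

sum-chain-halving : ∀ n m (z : Vector ℤ w) → Halving (m ℕ.+ n) z →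
  sum (chain n (suc m) z) ≡ 2ℤ * walks w n (suc m) - 2ℤ * walks w n m
sum-chain-halving {w} n m z h = begin
  sum (chain n (suc m) z)                         ≡⟨ sum-cong-≗ {w} (chain-halving n m z h) ⟩
  sum (λ i → 2ℤ * X i - 2ℤ * Y i)                 ≡⟨ sum-- (λ i → 2ℤ * X i) (λ i → 2ℤ * Y i) ⟩
  sum (λ i → 2ℤ * X i) - sum (λ i → 2ℤ * Y i)     ≡⟨ sym (cong₂ _-_ (*-distribˡ-sum 2ℤ X) (*-distribˡ-sum 2ℤ Y)) ⟩
  2ℤ * sum X - 2ℤ * sum Y                         ∎
  where
  X Y : Vector ℤ w
  X = chain n (suc m) (u w)
  Y = chain n m (u w)

halving-period : ∀ k n {z : Vector ℤ w} → Halving n z → Halving (k ℕ.* 2 ℕ.+ n) z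
halving-period zero    n h = h
halving-period (suc k) n h = halving-period k n h

-- In this and the next two lemmas the vector is 1 on the blocks J and 0 on the singleton blocks, so
-- a row reads 2 = 2 * 2 - 2 or 0 = 2 * 1 - 2. Singletons are absent from `blocks` for even w, last
-- in `blocks` for odd w, and first and last in `1-blocks` for even w.
halving-u : ∀ w → Even w → Halving 0 (u w)
halving-u (suc (suc w)) p zero    = trans (blockMatrix-0-zero (u (2 ℕ.+ w)))
  (sym (cong (λ r → 2ℤ * r - 2ℤ * 1ℤ) (blockMatrix-0-zero (u (2 ℕ.+ w)))))
halving-u (suc (suc w)) p (suc zero) = trans (blockMatrix-0-one (u (2 ℕ.+ w)))
  (sym (cong (λ r → 2ℤ * r - 2ℤ * 1ℤ) (blockMatrix-0-one (u (2 ℕ.+ w)))))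
halving-u (suc (suc w)) p (suc (suc i)) = trans (blockMatrix-0-suc (u (2 ℕ.+ w)) i)
  (trans (halving-u w p i) (sym (cong (λ r → 2ℤ * r - 2ℤ * 1ℤ) (blockMatrix-0-suc (u (2 ℕ.+ w)) i))))

halving-v : ∀ w → Odd w → Halving 0 (v w)
halving-v (suc zero)          p zero = refl
halving-v (suc (suc (suc w))) p zero = trans (blockMatrix-0-zero (v (3 ℕ.+ w)))
  (sym (cong (λ r → 2ℤ * r - 2ℤ * 1ℤ) (blockMatrix-0-zero (u (3 ℕ.+ w)))))
halving-v (suc (suc (suc w))) p (suc zero) = trans (blockMatrix-0-one (v (3 ℕ.+ w)))
  (sym (cong (λ r → 2ℤ * r - 2ℤ * 1ℤ) (blockMatrix-0-one (u (3 ℕ.+ w)))))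
halving-v (suc (suc (suc w))) p (suc (suc i)) = trans (blockMatrix-0-suc (v (3 ℕ.+ w)) i)
  (trans (halving-v (suc w) p i) (sym (cong (λ r → 2ℤ * r - 2ℤ * 1ℤ) (blockMatrix-0-suc (u (3 ℕ.+ w)) i))))

halving-t : ∀ w → Even w → Halving 1 (t w)
halving-t (suc w) p zero    = trans (blockMatrix-1-zero (t (suc w)))
  (sym (cong (λ r → 2ℤ * r - 2ℤ * 1ℤ) (blockMatrix-1-zero (u (suc w)))))
-- Without its first entry, `t` is the vector `v` of odd width.
halving-t (suc w) p (suc i) = trans (blockMatrix-1-suc (t (suc w)) i)
  (trans (halving-v w (odd⇔suc-even w .from p) i)
         (sym (cong (λ r → 2ℤ * r - 2ℤ * 1ℤ) (blockMatrix-1-suc (u (suc w)) i))))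

-- The block-diagonal matrices as wire matrices

blocks≗blockMatrix : ∀ w i j → blocks w i j ≡ blockMatrix 0 i j
blocks≗blockMatrix (suc zero)    zero          zero          = refl
blocks≗blockMatrix (suc (suc w)) zero          zero          = refl
blocks≗blockMatrix (suc (suc w)) zero          (suc zero)    = refl
blocks≗blockMatrix (suc (suc w)) zero          (suc (suc j)) = refl
blocks≗blockMatrix (suc (suc w)) (suc zero)    zero          = refl
blocks≗blockMatrix (suc (suc w)) (suc zero)    (suc zero)    = refl
blocks≗blockMatrix (suc (suc w)) (suc zero)    (suc (suc j)) = refl
blocks≗blockMatrix (suc (suc w)) (suc (suc i)) zero          = refl
blocks≗blockMatrix (suc (suc w)) (suc (suc i)) (suc zero)    = refl
blocks≗blockMatrix (suc (suc w)) (suc (suc i)) (suc (suc j)) = blocks≗blockMatrix w i j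

1-blocks≗blockMatrix : ∀ w i j → 1-blocks w i j ≡ blockMatrix 1 i j
1-blocks≗blockMatrix (suc w) zero    zero    = refl
1-blocks≗blockMatrix (suc w) zero    (suc j) = refl
1-blocks≗blockMatrix (suc w) (suc i) zero    = refl
1-blocks≗blockMatrix (suc w) (suc i) (suc j) = blocks≗blockMatrix w i j

module _ n (A B : Matrix w w) (A≗ : ∀ i j → A i j ≡ blockMatrix n i j)
         (B≗ : ∀ i j → B i j ≡ blockMatrix (suc n) i j) where

  power-chain : ∀ k (x : Vector ℤ w) i → ((A *ₘ B) ^ₘ k · x) i ≡ chain n (k ℕ.* 2) x i
  power-chain zero    x i = identity-· x i
  power-chain (suc k) x i = begin
    ((A *ₘ B) ^ₘ suc k · x) i             ≡⟨ ·-*ₘ (A *ₘ B) ((A *ₘ B) ^ₘ k) x i ⟩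
    ((A *ₘ B) · (A *ₘ B) ^ₘ k · x) i      ≡⟨ ·-*ₘ A B ((A *ₘ B) ^ₘ k · x) i ⟩
    (A · B · (A *ₘ B) ^ₘ k · x) i         ≡⟨ ·-cong A≗ (·-cong B≗ (λ j →
      trans (power-chain k x j) (sym (chain-period n (k ℕ.* 2) x j)))) i ⟩
    chain n (suc k ℕ.* 2) x i             ∎

  ⟨u∣power∣⟩ : ∀ k (x : Vector ℤ w) → ⟨ u w ∣ (A *ₘ B) ^ₘ k ∣ x ⟩ ≡ sum (chain n (k ℕ.* 2) x)
  ⟨u∣power∣⟩ k x = trans (⟨u∣∣⟩ ((A *ₘ B) ^ₘ k) x) (sum-cong-≗ (power-chain k x))

  ⟨u∣power-transpose∣u⟩ : ∀ k → ⟨ u w ∣ transpose ((A *ₘ B) ^ₘ k) ∣ u w ⟩ ≡ walks w n (k ℕ.* 2)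
  ⟨u∣power-transpose∣u⟩ k = trans (⟨u∣transpose∣u⟩ ((A *ₘ B) ^ₘ k)) (sum-cong-≗ (power-chain k (u w)))

  ⟨u∣odd-product∣⟩ : ∀ k (x : Vector ℤ w) →
    ⟨ u w ∣ B *ₘ (A *ₘ B) ^ₘ k ∣ x ⟩ ≡ sum (chain (suc n) (suc (k ℕ.* 2)) x)
  ⟨u∣odd-product∣⟩ k x = trans (⟨u∣∣⟩ (B *ₘ (A *ₘ B) ^ₘ k) x) (sum-cong-≗ (λ i → trans
    (·-*ₘ B ((A *ₘ B) ^ₘ k) x i)
    (·-cong B≗ (λ j → trans (power-chain k x j) (sym (chain-period n (k ℕ.* 2) x j))) i)))

⌊k*2/2⌋≡k : ∀ k → ⌊ k ℕ.* 2 /2⌋ ≡ k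
⌊k*2/2⌋≡k zero    = refl
⌊k*2/2⌋≡k (suc k) = cong suc (⌊k*2/2⌋≡k k)

ρ-even : ∀ k → ρ (2 ℕ.+ k ℕ.* 2) ≡ k
ρ-even zero    = refl
ρ-even (suc k) = cong suc (ρ-even k)

ρ-odd : ∀ k → ρ (3 ℕ.+ k ℕ.* 2) ≡ suc k
ρ-odd k = cong suc (⌊k*2/2⌋≡k k)

-- Unnormalised rationals avoid the gcd hidden in `_/_` and leave an integer identity.
neg≡-½*double : ∀ d → (- d) / 1 ≡ -½ *ℚ ((2ℤ * d) / 1)
neg≡-½*double d = ℚ.toℚᵘ-injective (begin-≃
  ℚ.toℚᵘ ((- d) / 1)                    ≈⟨ ℚ.toℚᵘ-fromℚᵘ (ℚᵘ.mkℚᵘ (- d) 0) ⟩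
  ℚᵘ.mkℚᵘ (- d) 0                       ≈⟨ ℚᵘ.*≡* (simplify d) ⟩
  ℚᵘ.-½ ℚᵘ.* ℚᵘ.mkℚᵘ (2ℤ * d) 0
    ≈⟨ ℚᵘ.*-congˡ {ℚᵘ.-½} (ℚᵘ.≃-sym (ℚ.toℚᵘ-fromℚᵘ (ℚᵘ.mkℚᵘ (2ℤ * d) 0))) ⟩
  ℚᵘ.-½ ℚᵘ.* ℚ.toℚᵘ ((2ℤ * d) / 1)      ≈⟨ ℚᵘ.≃-sym (ℚ.toℚᵘ-homo-* -½ ((2ℤ * d) / 1)) ⟩
  ℚ.toℚᵘ (-½ *ℚ ((2ℤ * d) / 1))         ∎-≃)
  where
  open ℚᵘ.≃-Reasoning renaming (begin_ to begin-≃_; _∎ to _∎-≃)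
  simplify : ∀ d → - d * 2ℤ ≡ -1ℤ * (2ℤ * d) * 1ℤ
  simplify = solve-∀

walks-cong : ∀ {a a′ b b′ c c′ : ℤ} → a ≡ a′ → b ≡ b′ → c ≡ c′ →
             - (a - b + (a - c)) ≡ - (a′ - b′ + (a′ - c′))
walks-cong refl refl refl = refl

collect : ∀ a b → - (a - b + (a - b)) ≡ - (2ℤ * a - 2ℤ * b)
collect = solve-∀

-- The formulas for each parity of width and length

module _ (w k : ℕ) where

  private
    halving-after-odd : ∀ n {z : Vector ℤ w} → Halving (suc n) z → Halving (suc (k ℕ.* 2) ℕ.+ n) z
    halving-after-odd n {z} h = subst (λ p → Halving p z) (ℕ.+-suc (k ℕ.* 2) n) (halving-period k (suc n) h)

  odd-width-even-length : Odd w → ∀ ty → P[ ty , 2 ℕ.+ k ℕ.* 2 , w , 3 ℕ.+ k ℕ.* 2 ] ≡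
    - ⟨ u w ∣ M-U w *ₘ (M-L w *ₘ M-U w) ^ₘ k ∣ v w ⟩
  odd-width-even-length odd ty = begin
    P[ ty , 2 ℕ.+ k ℕ.* 2 , w , 3 ℕ.+ k ℕ.* 2 ]
      ≡⟨ coefficient-walks ty (k ℕ.* 2) w ⟩
    - (walks w ν (suc (k ℕ.* 2)) - walks w ν (k ℕ.* 2) + (walks w ν (suc (k ℕ.* 2)) - walks w (suc ν) (k ℕ.* 2)))
      ≡⟨ walks-cong (reflect ν (suc (k ℕ.* 2))) (reflect ν (k ℕ.* 2)) (reflect (suc ν) (k ℕ.* 2)) ⟩
    - (a - b + (a - b))   ≡⟨ collect a b ⟩
    -- For odd w the starting index is free. An even one makes `M-U` both the first and the last of
    -- the odd number of factors, and `v` goes with `M-U`.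
    - (2ℤ * a - 2ℤ * b)   ≡⟨ cong -_ (sym (cong₂ (λ a b → 2ℤ * a - 2ℤ * b)
                               (reflect 2 (suc (k ℕ.* 2))) (reflect 2 (k ℕ.* 2)))) ⟩
    - (2ℤ * walks w 2 (suc (k ℕ.* 2)) - 2ℤ * walks w 2 (k ℕ.* 2))
      ≡⟨ cong -_ (sym (sum-chain-halving 2 (k ℕ.* 2) (v w) (halving-period k 2 (halving-v w odd)))) ⟩
    - sum (chain 2 (suc (k ℕ.* 2)) (v w))
      ≡⟨ cong -_ (sym (⟨u∣odd-product∣⟩ 1 (M-L w) (M-U w) (1-blocks≗blockMatrix w) (blocks≗blockMatrix w) k (v w))) ⟩
    - ⟨ u w ∣ M-U w *ₘ (M-L w *ₘ M-U w) ^ₘ k ∣ v w ⟩ ∎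
    where
    ν = offset ty ℕ.+ 1
    reflect = walks-reflect w odd
    a = walks w 0 (suc (k ℕ.* 2))
    b = walks w 0 (k ℕ.* 2)

  odd-width-odd-length : Odd w → ∀ ty → P[ ty , 3 ℕ.+ k ℕ.* 2 , w , 4 ℕ.+ k ℕ.* 2 ] ≡
    - ⟨ u w ∣ (M-L w *ₘ M-U w) ^ₘ suc k ∣ v w ⟩
  odd-width-odd-length odd ty = begin
    P[ ty , 3 ℕ.+ k ℕ.* 2 , w , 4 ℕ.+ k ℕ.* 2 ]
      ≡⟨ coefficient-walks ty μ w ⟩
    - (walks w ν (suc μ) - walks w ν μ + (walks w ν (suc μ) - walks w (suc ν) μ))
      ≡⟨ walks-cong (reflect ν (suc μ)) (reflect ν μ) (reflect (suc ν) μ) ⟩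
    - (a - b + (a - b))   ≡⟨ collect a b ⟩
    - (2ℤ * a - 2ℤ * b)   ≡⟨ cong -_ (sym (cong₂ (λ a b → 2ℤ * a - 2ℤ * b) (reflect 1 (suc μ)) (reflect 1 μ))) ⟩
    - (2ℤ * walks w 1 (suc μ) - 2ℤ * walks w 1 μ)
      ≡⟨ cong -_ (sym (sum-chain-halving 1 μ (v w) (halving-after-odd 1 (halving-v w odd)))) ⟩
    - sum (chain 1 (suc μ) (v w))
      ≡⟨ cong -_ (sym (⟨u∣power∣⟩ 1 (M-L w) (M-U w) (1-blocks≗blockMatrix w) (blocks≗blockMatrix w) (suc k) (v w))) ⟩
    - ⟨ u w ∣ (M-L w *ₘ M-U w) ^ₘ suc k ∣ v w ⟩ ∎
    where
    ν = offset ty ℕ.+ 1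
    μ = suc (k ℕ.* 2)
    reflect = walks-reflect w odd
    a = walks w 0 (suc μ)
    b = walks w 0 μ

  even-width-even-length-first : Even w → P[ first , 2 ℕ.+ k ℕ.* 2 , w , 3 ℕ.+ k ℕ.* 2 ] ≡
    - ⟨ u w ∣ M₋ w *ₘ (M₊ w *ₘ M₋ w) ^ₘ k ∣ t w ⟩
  even-width-even-length-first even = begin
    P[ first , 2 ℕ.+ k ℕ.* 2 , w , 3 ℕ.+ k ℕ.* 2 ]
      ≡⟨ coefficient-walks first (k ℕ.* 2) w ⟩
    - (a - b + (a - walks w 2 (k ℕ.* 2)))
      -- The shorter products have l - 2 factors, an even number, so reversal identifies their two
      -- starting indices.
      ≡⟨ walks-cong {a} {b = b} refl refl (walks-reverse w 1 k) ⟩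
    - (a - b + (a - b))   ≡⟨ collect a b ⟩
    - (2ℤ * a - 2ℤ * b)
      ≡⟨ cong -_ (sym (sum-chain-halving 1 (k ℕ.* 2) (t w) (halving-period k 1 (halving-t w even)))) ⟩
    - sum (chain 1 (suc (k ℕ.* 2)) (t w))
      ≡⟨ cong -_ (sym (⟨u∣odd-product∣⟩ 0 (M₊ w) (M₋ w) (blocks≗blockMatrix w) (1-blocks≗blockMatrix w) k (t w))) ⟩
    - ⟨ u w ∣ M₋ w *ₘ (M₊ w *ₘ M₋ w) ^ₘ k ∣ t w ⟩ ∎
    where
    a = walks w 1 (suc (k ℕ.* 2))
    b = walks w 1 (k ℕ.* 2)

  even-width-even-length-second : Even w → P[ second , 2 ℕ.+ k ℕ.* 2 , w , 3 ℕ.+ k ℕ.* 2 ] ≡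
    - ⟨ u w ∣ M₊ w *ₘ (M₋ w *ₘ M₊ w) ^ₘ k ∣ u w ⟩
  even-width-even-length-second even = begin
    P[ second , 2 ℕ.+ k ℕ.* 2 , w , 3 ℕ.+ k ℕ.* 2 ]
      ≡⟨ coefficient-walks second (k ℕ.* 2) w ⟩
    - (a - b + (a - walks w 3 (k ℕ.* 2)))
      ≡⟨ walks-cong {a} {b = b} refl refl (walks-reverse w 2 k) ⟩
    - (a - b + (a - b))   ≡⟨ collect a b ⟩
    - (2ℤ * a - 2ℤ * b)
      ≡⟨ cong -_ (sym (sum-chain-halving 2 (k ℕ.* 2) (u w) (halving-period k 2 (halving-u w even)))) ⟩
    - sum (chain 2 (suc (k ℕ.* 2)) (u w))
      ≡⟨ cong -_ (sym (⟨u∣odd-product∣⟩ 1 (M₋ w) (M₊ w) (1-blocks≗blockMatrix w) (blocks≗blockMatrix w) k (u w))) ⟩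
    - ⟨ u w ∣ M₊ w *ₘ (M₋ w *ₘ M₊ w) ^ₘ k ∣ u w ⟩ ∎
    where
    a = walks w 2 (suc (k ℕ.* 2))
    b = walks w 2 (k ℕ.* 2)

  even-width-odd-length : Even w → ∀ ty → P[ ty , 3 ℕ.+ k ℕ.* 2 , w , 4 ℕ.+ k ℕ.* 2 ] / 1 ≡
    -½ *ℚ ((⟨ u w ∣ (M₊ w *ₘ M₋ w) ^ₘ suc k ∣ t w ⟩
           + ⟨ u w ∣ transpose ((M₊ w *ₘ M₋ w) ^ₘ suc k) ∣ u w ⟩) / 1)
  even-width-odd-length even ty =
    trans (cong (_/ 1) (coefficient ty))
      (trans (neg≡-½*double (a 1 - b 1 + (a 1 - b 0))) (cong (λ s → -½ *ℚ (s / 1)) (sym bilinear)))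
    where
    μ = suc (k ℕ.* 2)
    a b : ℕ → ℤ
    a i = walks w i (suc μ)
    b i = walks w i μ

    -- Reversal identifies `a 0` with `a 1`, which have an even number of factors. The odd products
    -- behind `b 0` and `b 1` are palindromes, so reversal does not relate them; but both types
    -- subtract each of them once.
    coefficient : ∀ ty → P[ ty , 2 ℕ.+ μ , w , 3 ℕ.+ μ ] ≡ - (a 1 - b 1 + (a 1 - b 0))
    coefficient first  = trans (coefficient-walks first μ w)
      (walks-cong {a 1} {b = b 1} refl refl (walks-period w 0 μ))
    coefficient second = trans (coefficient-walks second μ w)
      (trans (walks-cong (walks-reverse w 1 (suc k)) (walks-period w 0 μ) (walks-period w 1 μ))
             (exchange (a 1) (b 0) (b 1)))
      where
      exchange : ∀ a b c → - (a - b + (a - c)) ≡ - (a - c + (a - b))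
      exchange = solve-∀

    bilinear : ⟨ u w ∣ (M₊ w *ₘ M₋ w) ^ₘ suc k ∣ t w ⟩ + ⟨ u w ∣ transpose ((M₊ w *ₘ M₋ w) ^ₘ suc k) ∣ u w ⟩
             ≡ 2ℤ * (a 1 - b 1 + (a 1 - b 0))
    bilinear = begin
      ⟨ u w ∣ (M₊ w *ₘ M₋ w) ^ₘ suc k ∣ t w ⟩ + ⟨ u w ∣ transpose ((M₊ w *ₘ M₋ w) ^ₘ suc k) ∣ u w ⟩
        ≡⟨ cong₂ _+_ (⟨u∣power∣⟩ 0 (M₊ w) (M₋ w) (blocks≗blockMatrix w) (1-blocks≗blockMatrix w) (suc k) (t w))
                     (⟨u∣power-transpose∣u⟩ 0 (M₊ w) (M₋ w) (blocks≗blockMatrix w) (1-blocks≗blockMatrix w) (suc k)) ⟩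
      sum (chain 0 (suc μ) (t w)) + a 0
        ≡⟨ cong₂ _+_ (sum-chain-halving 0 μ (t w) (halving-after-odd 0 (halving-t w even)))
                     (sym (walks-reverse w 0 (suc k))) ⟩
      2ℤ * a 0 - 2ℤ * b 0 + a 1
        -- The transposed product starts with `M₋` and ends with `M₊`, for which `u` itself is a
        -- halving vector: this trades `a 1` for 2 `a 1` - 2 `b 1`. Each of the two terms is thus
        -- twice a difference, which accounts for the factor one half.
        ≡⟨ cong₂ _+_ (cong (λ z → 2ℤ * z - 2ℤ * b 0) (sym (walks-reverse w 0 (suc k))))
                     (sum-chain-halving 1 μ (u w) (halving-after-odd 1 (halving-u w even))) ⟩
      2ℤ * a 1 - 2ℤ * b 0 + (2ℤ * a 1 - 2ℤ * b 1)
        ≡⟨ arrange (a 1) (b 0) (b 1) ⟩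
      2ℤ * (a 1 - b 1 + (a 1 - b 0)) ∎
      where
      arrange : ∀ a b c → 2ℤ * a - 2ℤ * b + (2ℤ * a - 2ℤ * c) ≡ 2ℤ * (a - c + (a - b))
      arrange = solve-∀

mainTheorem6 :
  (l w : ℕ) → 2 ≤ l → 2 ≤ w →
  -- (a)
  (Odd w → (ty : NetworkType) →
    (Odd l →
      P[ ty , l , w , suc l ] ≡ - ⟨ u w ∣ (M-L w *ₘ M-U w) ^ₘ ρ l ∣ v w ⟩) ×
    (Even l →
      P[ ty , l , w , suc l ] ≡ - ⟨ u w ∣ M-U w *ₘ (M-L w *ₘ M-U w) ^ₘ ρ l ∣ v w ⟩)) ×
  -- (b)
  (Even w → Even l →
    P[ first , l , w , suc l ] ≡ - ⟨ u w ∣ M₋ w *ₘ (M₊ w *ₘ M₋ w) ^ₘ ρ l ∣ t w ⟩) ×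
  -- (c)
  (Even w → Even l →
    P[ second , l , w , suc l ] ≡ - ⟨ u w ∣ M₊ w *ₘ (M₋ w *ₘ M₊ w) ^ₘ ρ l ∣ u w ⟩) ×
  -- (d)
  (Even w → Odd l → (ty : NetworkType) →
    P[ ty , l , w , suc l ] / 1 ≡
      -½ *ℚ ((⟨ u w ∣ (M₊ w *ₘ M₋ w) ^ₘ ρ l ∣ t w ⟩
             + ⟨ u w ∣ transpose ((M₊ w *ₘ M₋ w) ^ₘ ρ l) ∣ u w ⟩) / 1))
mainTheorem6 (suc (suc m)) w (s≤s (s≤s z≤n)) _ =
    (λ odd ty →
      (λ p → case odd-double m p of λ where
        (k , refl) → trans (odd-width-odd-length w k odd ty)
          (cong (λ r → - ⟨ u w ∣ (M-L w *ₘ M-U w) ^ₘ r ∣ v w ⟩) (sym (ρ-odd k)))) ,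
      (λ p → case even-double m p of λ where
        (k , refl) → trans (odd-width-even-length w k odd ty)
          (cong (λ r → - ⟨ u w ∣ M-U w *ₘ (M-L w *ₘ M-U w) ^ₘ r ∣ v w ⟩) (sym (ρ-even k)))))
  , (λ even p → case even-double m p of λ where
      (k , refl) → trans (even-width-even-length-first w k even)
        (cong (λ r → - ⟨ u w ∣ M₋ w *ₘ (M₊ w *ₘ M₋ w) ^ₘ r ∣ t w ⟩) (sym (ρ-even k))))
  , (λ even p → case even-double m p of λ where
      (k , refl) → trans (even-width-even-length-second w k even)
        (cong (λ r → - ⟨ u w ∣ M₊ w *ₘ (M₋ w *ₘ M₊ w) ^ₘ r ∣ u w ⟩) (sym (ρ-even k))))
  , (λ even p ty → case odd-double m p of λ where
      (k , refl) → trans (even-width-odd-length w k even ty)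
        (cong (λ r → -½ *ℚ ((⟨ u w ∣ (M₊ w *ₘ M₋ w) ^ₘ r ∣ t w ⟩
          + ⟨ u w ∣ transpose ((M₊ w *ₘ M₋ w) ^ₘ r) ∣ u w ⟩) / 1)) (sym (ρ-odd k))))
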